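{- Let $p$ be a prime, and let $a\in\mathbb Z^+$ and $l\in\mathbb N$. If $n=(l+1)p^{a-1}-1+m\,\phi(p^a)$ for some $m\in\mathbb Z^+$, then $$\left\{\begin{matrix} n\\ r\end{matrix}\right\}_{l,p^{a}}\equiv(-1)^{m-1}\binom{m-1}l\pmod p\quad\text{for all } r\in\mathbb Z.$$
   Context: $\mathbb N=\{0,1,2,\ldots\}$; $\phi$ is Euler's totient function. Binomial coefficients: $\binom x0=1$, $\binom xk=x(x-1)\cdots(x-k+1)/k!$ for $k\in\mathbb Z^+$ (for rational $x$), and $\binom xk=0$ for negative integers $k$. For a prime $p$, $b\in\mathbb Z^+$, $l,n\in\mathbb N$ and $r\in\mathbb Z$, $$\left\{\begin{matrix} n\\ r\end{matrix}\right\}_{l,p^{b}}:=p^{ -\left\lfloor\frac{n-p^{b-1}-lp^{b}}{\phi(p^{b})}\right\rfloor}\sum_{k\equiv r\,(\mathrm{mod}\ p^{b})}(-1)^k\binom nk\binom{(k-r)/p^{b}}l,$$ the sum over all integers $k\equiv r\pmod{p^b}$. These numbers are integers. -}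

module Defs where

open import Data.Nat as ℕ using (ℕ; zero; suc; _∸_)
open import Data.Nat.Combinatorics using (_C_)
open import Data.Nat.Coprimality using (coprime?)
open import Data.List using (List; []; _∷_; filter; length; upTo; map; foldr)
open import Data.Integer as ℤ using (ℤ; +_; -[1+_]; _/ℕ_; _%ℕ_)
open import Data.Rational as ℚ using (ℚ)
open import Relation.Nullary.Decidable using (does)
open import Data.Bool using (if_then_else_)

φ : ℕ → ℕ
φ n = length (filter (λ k → coprime? k n) (map suc (upTo n)))

ℤ→ℚ : ℤ → ℚ
ℤ→ℚ z = z ℚ./ 1

binomℚ : ℚ → ℕ → ℚ
binomℚ x zero    = ℚ.1ℚ
binomℚ x (suc k) = binomℚ x k ℚ.* ((x ℚ.- ℤ→ℚ (+ k)) ℚ.* ((+ 1) ℚ./ suc k))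

sgnℚ : ℕ → ℚ
sgnℚ zero    = ℚ.1ℚ
sgnℚ (suc k) = ℚ.- sgnℚ k

-- floor division of an integer by a natural (value irrelevant for d = 0)
floorDiv : ℤ → ℕ → ℤ
floorDiv x zero    = + 0
floorDiv x (suc d) = x /ℕ suc d

congB : ℤ → ℤ → ℕ → Data.Bool.Bool
congB x r zero    = does (x ℤ.≟ r)
congB x r (suc d) = does (((x ℤ.- r) %ℕ suc d) ℕ.≟ 0)

-- Σ_{k ≡ r (mod p^b)} (-1)^k C(n,k) C((k-r)/p^b, l).
-- Since C(n,k) = 0 unless 0 ≤ k ≤ n, the sum ranges over k ∈ {0,…,n}.
innerSum : ℕ → ℤ → ℕ → ℕ → ℕ → ℚ
innerSum n r l p b =
  foldr ℚ._+_ ℚ.0ℚ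
    (map (λ k → if congB (+ k) r (p ℕ.^ b)
                then sgnℚ k ℚ.* (ℤ→ℚ (+ (n C k)) ℚ.*
                       binomℚ (ℤ→ℚ ((+ k) ℤ.- r) ℚ.* invPow) l)
                else ℚ.0ℚ)
         (upTo (suc n)))
  where
  -- 1 / p^b as a rational (p^b = 0 only if p = 0, excluded in use)
  invPow : ℚ
  invPow with p ℕ.^ b
  ... | zero  = ℚ.0ℚ
  ... | suc q = (+ 1) ℚ./ suc q

powℤℚ : ℕ → ℤ → ℚ
powℤℚ p (+ e)     = ℤ→ℚ (+ (p ℕ.^ e))
powℤℚ p -[1+ e ] with p ℕ.^ suc e
... | zero  = ℚ.0ℚ
... | suc q = (+ 1) ℚ./ suc q

bracketExp : ℕ → ℕ → ℕ → ℕ → ℤ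
bracketExp n l p b =
  floorDiv ((+ n) ℤ.- (+ (p ℕ.^ (b ∸ 1))) ℤ.- (+ (l ℕ.* p ℕ.^ b))) (φ (p ℕ.^ b))

bracket : ℕ → ℤ → ℕ → ℕ → ℕ → ℚ
bracket n r l p b = powℤℚ p (ℤ.- bracketExp n l p b) ℚ.* innerSum n r l p b

{-# OPTIONS --safe #-}
module Submission where

-- Let X be the shift on sequences ℤ → ℤ, z = 1 − X, Q = p^(a−1), q = p^a, and let δ l be the
-- sequence equal to C(s/q, l) at the multiples s of q and to 0 elsewhere.  The sum of the
-- statement is (z^n δ l)(−r), and X^q δ (l+1) = δ (l+1) + δ l, X^q δ 0 = δ 0.
-- Modulo p, z^Q agrees with w = 1 − X^Q, and 1 − X^q = w^p + p w u with u = 1 on constants.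
-- Writing n = Q − 1 + Q (l + m (p − 1)), this turns z^(Q−1) w^(l + m (p−1)) δ l into a
-- sequence obeying the Pascal recursion of (−1)^(m−1) C(m−1, l) p^(m−1−l) modulo p^(m−l);
-- replacing w by z^Q costs a multiple of p z, and z annihilates constants, so nothing is lost.

open import Defs
open import Algebra.Bundles using (CommutativeSemiring)
open import Data.Bool using (true; false; if_then_else_)
open import Data.Empty using (⊥-elim)
open import Data.List using (List; []; _∷_; foldr; map; upTo; applyUpTo; filter; length; _∷ʳ_; _++_)
import Data.List.Properties as List
open import Data.Nat as ℕ using (ℕ; zero; suc; s≤s; z≤n)
import Data.Nat.Properties as ℕ
import Data.Nat.Divisibility as ℕ
import Data.Nat.DivMod as ℕ
open import Data.Nat.Combinatorics using (_C_; nCn≡1; nC1≡n; k>n⇒nCk≡0; nCk+nC[k+1]≡[n+1]C[k+1])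
open import Data.Nat.Coprimality using (Coprime; coprime?; coprime-divisor)
open import Data.Nat.Primality using (Prime; euclidsLemma; prime⇒nonZero; prime⇒nonTrivial; prime⇒irreducible; ¬prime[0]; ¬prime[1])
import Data.Nat.Tactic.RingSolver as ℕ-Tactic
open import Data.Integer as ℤ using (ℤ; +_; -[1+_]; 0ℤ; 1ℤ; -1ℤ)
import Data.Integer.Properties as ℤ
import Data.Integer.DivMod as ℤ
import Data.Integer.Tactic.RingSolver as ℤ-Tactic
open import Data.Integer.Divisibility.Signed as ℤ∣ using () renaming (_∣_ to _∣ᶻ_)
open import Data.Rational as ℚ using (ℚ; 0ℚ; 1ℚ; toℚᵘ)
import Data.Rational.Properties as ℚ
import Data.Rational.Solver as ℚ-Solver
open import Data.Rational.Unnormalised as ℚᵘ using (mkℚᵘ; *≡*)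
import Data.Rational.Unnormalised.Properties as ℚᵘ
open import Data.Product using (∃; _×_; _,_; proj₁; proj₂)
open import Data.Sum using (inj₁; inj₂)
open import Function using (_∘_)
open import Level using (Level; 0ℓ)
open import Relation.Binary.PropositionalEquality as ≡ using (_≡_)
open import Relation.Nullary using (¬_; yes; no)
open import Algebra.Properties.AbelianGroup ℤ.+-0-abelianGroup using (∙-cancelʳ)

-- The obstacle is precision. The answer is needed modulo a power of p that grows with m, while
-- replacing 1 - X^Q by z^Q is correct only modulo p. Hence `w` carries its error term and equals 1
-- - X^Q exactly, and w^p = (1 - X^q) - p w u is an exact identity. One use of it on p factors `w`
-- lowers m by one and gives a factor p. The part 1 - X^q lowers l, producing a second p from the
-- scaling p^l; the part p w u keeps l. These two branches are the two parents in Pascal's triangle.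
-- The induction runs through constants. For the given n, p^l z^n δ l is constant modulo p^m, which
-- is why r is absent from the right-hand side, and one further factor z makes it vanish there. This
-- extra vanishing pays for returning from `w` to z^Q, provided that the error in `w` is p times a
-- multiple of z, and not merely a multiple of p.

[1+k]*[1+n]C[1+k]≡[1+n]*nCk : ∀ n k → suc k ℕ.* (suc n C suc k) ≡ suc n ℕ.* (n C k)
[1+k]*[1+n]C[1+k]≡[1+n]*nCk n zero = begin
  1 ℕ.* (suc n C 1) ≡⟨ ℕ.*-identityˡ _ ⟩
  suc n C 1         ≡⟨ nC1≡n (suc n) ⟩
  suc n             ≡⟨ ℕ.*-identityʳ (suc n) ⟨
  suc n ℕ.* 1       ∎
  where open ≡.≡-Reasoning
[1+k]*[1+n]C[1+k]≡[1+n]*nCk zero (suc k) = ℕ.*-zeroʳ (suc (suc k))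
[1+k]*[1+n]C[1+k]≡[1+n]*nCk (suc n) (suc k) = begin
  suc (suc k) ℕ.* (suc (suc n) C suc (suc k))
    ≡⟨ ≡.cong (suc (suc k) ℕ.*_) (nCk+nC[k+1]≡[n+1]C[k+1] (suc n) (suc k)) ⟨
  suc (suc k) ℕ.* ((suc n C suc k) ℕ.+ (suc n C suc (suc k)))
    ≡⟨ expand k (suc n C suc k) (suc n C suc (suc k)) ⟩
  (suc n C suc k) ℕ.+ (suc k ℕ.* (suc n C suc k) ℕ.+ suc (suc k) ℕ.* (suc n C suc (suc k)))
    ≡⟨ ≡.cong ((suc n C suc k) ℕ.+_) (≡.cong₂ ℕ._+_ ([1+k]*[1+n]C[1+k]≡[1+n]*nCk n k) ([1+k]*[1+n]C[1+k]≡[1+n]*nCk n (suc k))) ⟩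
  (suc n C suc k) ℕ.+ (suc n ℕ.* (n C k) ℕ.+ suc n ℕ.* (n C suc k))
    ≡⟨ ≡.cong ((suc n C suc k) ℕ.+_) (ℕ.*-distribˡ-+ (suc n) (n C k) (n C suc k)) ⟨
  (suc n C suc k) ℕ.+ suc n ℕ.* ((n C k) ℕ.+ (n C suc k))
    ≡⟨ ≡.cong (λ c → (suc n C suc k) ℕ.+ suc n ℕ.* c) (nCk+nC[k+1]≡[n+1]C[k+1] n k) ⟩
  suc (suc n) ℕ.* (suc n C suc k) ∎
  where
  open ≡.≡-Reasoning
  expand : ∀ k a b → suc (suc k) ℕ.* (a ℕ.+ b) ≡ a ℕ.+ (suc k ℕ.* a ℕ.+ suc (suc k) ℕ.* b)
  expand = ℕ-Tactic.solve-∀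

-- By absorption p divides (k+1) C(p, k+1), and it cannot divide k+1, which lies between 0 and p.
prime∣pC[1+k] : ∀ {p} → Prime p → ∀ {k} → suc k ℕ.< p → p ℕ.∣ (p C suc k)
prime∣pC[1+k] {zero} pp = ⊥-elim (¬prime[0] pp)
prime∣pC[1+k] {suc n} pp {k} 1+k<p
  with euclidsLemma (suc k) (suc n C suc k) pp
         (≡.subst (suc n ℕ.∣_) (≡.sym ([1+k]*[1+n]C[1+k]≡[1+n]*nCk n k)) (ℕ.m∣m*n (n C k)))
... | inj₁ p∣1+k = ⊥-elim (ℕ.<⇒≱ 1+k<p (ℕ.∣⇒≤ p∣1+k))
... | inj₂ p∣C   = p∣C

-- The binomial theorem and Frobenius in commutative semirings

module CommutativeSemiringLemmas {c ℓ : Level} (R : CommutativeSemiring c ℓ) where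
  open CommutativeSemiring R
  open import Algebra.Properties.Semiring.Exp semiring
  open import Algebra.Properties.Semiring.Mult semiring using (×-congˡ; ×-homo-+; ×-homo-1; ×1-homo-*) renaming (_×_ to _·×_)
  open import Algebra.Solver.Ring.NaturalCoefficients.Default R
    using (solve; _:+_; _:*_; _:=_) renaming (con to :con)
  open import Relation.Binary.Reasoning.Setoid setoid

  ι : ℕ → Carrier
  ι n = n ·× 1#

  -- The form with terms c k x^(n-k) y^k for k ≤ n, in Horner style in y, so that no truncated
  -- exponent n - k is written.
  ∑ᶜ : (ℕ → ℕ) → ℕ → Carrier → Carrier → Carrier
  ∑ᶜ c zero    x y = ι (c 0)
  ∑ᶜ c (suc n) x y = ι (c 0) * x ^ suc n + y * ∑ᶜ (c ∘ suc) n x y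

  ∑ᶜ-cong : ∀ {c d} n x y → (∀ k → k ℕ.≤ n → c k ≡ d k) → ∑ᶜ c n x y ≈ ∑ᶜ d n x y
  ∑ᶜ-cong zero    x y c≡d = ×-congˡ (c≡d 0 z≤n)
  ∑ᶜ-cong (suc n) x y c≡d =
    +-cong (*-congʳ (×-congˡ (c≡d 0 z≤n))) (*-congˡ (∑ᶜ-cong n x y (λ k k≤n → c≡d (suc k) (s≤s k≤n))))

  ∑ᶜ-+ : ∀ c d n x y → ∑ᶜ (λ k → c k ℕ.+ d k) n x y ≈ ∑ᶜ c n x y + ∑ᶜ d n x y
  ∑ᶜ-+ c d zero    x y = ×-homo-+ 1# (c 0) (d 0)
  ∑ᶜ-+ c d (suc n) x y = trans
    (+-cong (*-congʳ (×-homo-+ 1# (c 0) (d 0))) (*-congˡ (∑ᶜ-+ (c ∘ suc) (d ∘ suc) n x y)))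
    (solve 6 (λ a b x^ y s t → (a :+ b) :* x^ :+ y :* (s :+ t) := (a :* x^ :+ y :* s) :+ (b :* x^ :+ y :* t))
      refl (ι (c 0)) (ι (d 0)) (x ^ suc n) y (∑ᶜ (c ∘ suc) n x y) (∑ᶜ (d ∘ suc) n x y))

  ∑ᶜ-* : ∀ m c n x y → ∑ᶜ (λ k → m ℕ.* c k) n x y ≈ ι m * ∑ᶜ c n x y
  ∑ᶜ-* m c zero    x y = ×1-homo-* m (c 0)
  ∑ᶜ-* m c (suc n) x y = trans
    (+-cong (*-congʳ (×1-homo-* m (c 0))) (*-congˡ (∑ᶜ-* m (c ∘ suc) n x y)))
    (solve 5 (λ m a x^ y s → (m :* a) :* x^ :+ y :* (m :* s) := m :* (a :* x^ :+ y :* s))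
      refl (ι m) (ι (c 0)) (x ^ suc n) y (∑ᶜ (c ∘ suc) n x y))

  ∑ᶜ-last : ∀ c n x y → ∑ᶜ c (suc n) x y ≈ x * ∑ᶜ c n x y + ι (c (suc n)) * y ^ suc n
  ∑ᶜ-last c zero    x y =
    solve 4 (λ a b x y → a :* (x :* :con 1) :+ y :* b := x :* a :+ b :* (y :* :con 1))
      refl (ι (c 0)) (ι (c 1)) x y
  ∑ᶜ-last c (suc n) x y = trans
    (+-congˡ (*-congˡ (∑ᶜ-last (c ∘ suc) n x y)))
    (solve 7 (λ a b x y x^ y^ s → a :* (x :* x^) :+ y :* (x :* s :+ b :* y^) := x :* (a :* x^ :+ y :* s) :+ b :* (y :* y^))
      refl (ι (c 0)) (ι (c (suc (suc n)))) x y (x ^ suc n) (y ^ suc n) (∑ᶜ (c ∘ suc) n x y))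

  binomial : ∀ n x y → (x + y) ^ n ≈ ∑ᶜ (n C_) n x y
  binomial zero    x y = sym (×-homo-1 1#)
  binomial (suc n) x y = begin
    (x + y) * (x + y) ^ n                                 ≈⟨ *-congˡ (binomial n x y) ⟩
    (x + y) * S                                           ≈⟨ distribʳ S x y ⟩
    x * S + y * S                                         ≈⟨ +-congʳ shifted ⟩
    (ι 1 * x ^ suc n + y * S′) + y * S                    ≈⟨ solve 4 (λ a y s s′ → (a :+ y :* s′) :+ y :* s := a :+ y :* (s :+ s′)) refl (ι 1 * x ^ suc n) y S S′ ⟩
    ι 1 * x ^ suc n + y * (S + S′)                        ≈⟨ +-congˡ (*-congˡ (∑ᶜ-+ (n C_) (λ k → n C suc k) n x y)) ⟨
    ι 1 * x ^ suc n + y * ∑ᶜ (λ k → (n C k) ℕ.+ (n C suc k)) n x y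
      ≈⟨ +-congˡ (*-congˡ (∑ᶜ-cong n x y (λ k _ → nCk+nC[k+1]≡[n+1]C[k+1] n k))) ⟩
    ∑ᶜ (suc n C_) (suc n) x y                             ∎
    where
    S S′ : Carrier
    S  = ∑ᶜ (n C_) n x y
    S′ = ∑ᶜ (λ k → n C suc k) n x y
    -- The vanishing term C(n, n+1) y^(n+1) is added so that the sum can be opened at its other end;
    -- this shifts the index as Pascal's rule requires.
    shifted : x * S ≈ ι 1 * x ^ suc n + y * S′
    shifted = begin
      x * S                                  ≈⟨ +-identityʳ _ ⟨
      x * S + 0#                             ≈⟨ +-congˡ (zeroˡ _) ⟨
      x * S + ι 0 * y ^ suc n                ≈⟨ +-congˡ (*-congʳ (×-congˡ (k>n⇒nCk≡0 (ℕ.n<1+n n)))) ⟨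
      x * S + ι (n C suc n) * y ^ suc n      ≈⟨ ∑ᶜ-last (n C_) n x y ⟨
      ι 1 * x ^ suc n + y * S′               ∎

  -- Splitting off x ^ (p ∸ 1) keeps track of the cofactor of p x y modulo y.
  frobenius : ∀ {p} → Prime p → ∀ x y → ∃ λ s →
    (x + y) ^ p ≈ x ^ p + ι p * (y * (x ^ (p ℕ.∸ 1) + y * s)) + y ^ p
  frobenius {0} pp = ⊥-elim (¬prime[0] pp)
  frobenius {1} pp = ⊥-elim (¬prime[1] pp)
  frobenius {p@(suc (suc n))} pp x y = x * proj₁ tail , (begin
    (x + y) ^ p                                                   ≈⟨ binomial p x y ⟩
    ι 1 * x ^ p + y * ∑ᶜ (λ k → p C suc k) (suc n) x y            ≈⟨ +-cong (*-congʳ (×-homo-1 1#)) (*-congˡ (∑ᶜ-last (λ k → p C suc k) n x y)) ⟩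
    1# * x ^ p + y * (x * ∑ᶜ (λ k → p C suc k) n x y + ι (p C p) * y ^ suc n)
      ≈⟨ +-congˡ (*-congˡ (+-cong (*-congˡ middle) (*-congʳ (trans (×-congˡ (nCn≡1 p)) (×-homo-1 1#))))) ⟩
    1# * x ^ p + y * (x * (ι p * (x ^ n + y * proj₁ tail)) + 1# * y ^ suc n)
      ≈⟨ solve 7 (λ x^p P x y x^n s y^ → :con 1 :* x^p :+ y :* (x :* (P :* (x^n :+ y :* s)) :+ :con 1 :* y^)
                   := x^p :+ P :* (y :* (x :* x^n :+ y :* (x :* s))) :+ y :* y^)
           refl (x ^ p) (ι p) x y (x ^ n) (proj₁ tail) (y ^ suc n) ⟩
    x ^ p + ι p * (y * (x ^ suc n + y * (x * proj₁ tail))) + y ^ p ∎)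
    where
    -- The inner coefficients divided by p. Since C(p, 1) / p = 1, the leading power of x has
    -- coefficient 1.
    b : ℕ → ℕ
    b k = (p C suc k) ℕ./ p
    b-0 : b 0 ≡ 1
    b-0 = ≡.trans (≡.cong (ℕ._/ p) (nC1≡n p)) (ℕ.n/n≡1 p)
    head-tail : ∀ m → ∃ λ s → ∑ᶜ b m x y ≈ x ^ m + y * s
    head-tail zero    = 0# , trans (×-congˡ b-0) (trans (×-homo-1 1#) (sym (trans (+-congˡ (zeroʳ y)) (+-identityʳ 1#))))
    head-tail (suc m) = ∑ᶜ (b ∘ suc) m x y ,
      +-congʳ (trans (*-congʳ (trans (×-congˡ b-0) (×-homo-1 1#))) (*-identityˡ _))
    tail : ∃ λ s → ∑ᶜ b n x y ≈ x ^ n + y * s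
    tail = head-tail n
    middle : ∑ᶜ (λ k → p C suc k) n x y ≈ ι p * (x ^ n + y * proj₁ tail)
    middle = begin
      ∑ᶜ (λ k → p C suc k) n x y ≈⟨ ∑ᶜ-cong n x y (λ k k≤n → ≡.sym (ℕ.m*[n/m]≡n (prime∣pC[1+k] pp (s≤s (s≤s k≤n))))) ⟩
      ∑ᶜ (λ k → p ℕ.* b k) n x y ≈⟨ ∑ᶜ-* p b n x y ⟩
      ι p * ∑ᶜ b n x y           ≈⟨ *-congˡ (proj₂ tail) ⟩
      ι p * (x ^ n + y * proj₁ tail) ∎

  ^-+-quotient : ∀ n x y → ∃ λ k → (x + y) ^ n ≈ x ^ n + y * k
  ^-+-quotient zero    x y = 0# , sym (trans (+-congˡ (zeroʳ y)) (+-identityʳ 1#))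
  ^-+-quotient (suc n) x y with k , eq ← ^-+-quotient n x y =
    x ^ n + (x + y) * k , trans (*-congˡ eq)
      (solve 4 (λ x y x^ k → (x :+ y) :* (x^ :+ y :* k) := x :* x^ :+ y :* (x^ :+ (x :+ y) :* k)) refl x y (x ^ n) k)

  1^n≈1 : ∀ n → 1# ^ n ≈ 1#
  1^n≈1 zero    = refl
  1^n≈1 (suc n) = trans (*-identityˡ _) (1^n≈1 n)

  x^n≈x*x^[n∸1] : ∀ x n .{{_ : ℕ.NonZero n}} → x ^ n ≈ x * x ^ (n ℕ.∸ 1)
  x^n≈x*x^[n∸1] x (suc n) = refl

  -- The error is kept in the form p z h because a later factor z must be extracted from it. In the
  -- induction step the summand w that completes x^(p^b) to 1 is itself z j. Frobenius then
  -- contributes p z j u, and expanding w^p around (z^(p^b))^p contributes p z h k.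
  x+z≈1⇒x^pᵇ+z^pᵇ≈1 : ∀ {p} → Prime p → ∀ {x z} → x + z ≈ 1# → ∀ b → ∃ λ h →
    x ^ (p ℕ.^ b) + (z ^ (p ℕ.^ b) + ι p * (z * h)) ≈ 1#
  x+z≈1⇒x^pᵇ+z^pᵇ≈1 {p} pp {x} {z} x+z≈1 zero = 0# ,
    trans (solve 3 (λ x z P → x :* :con 1 :+ (z :* :con 1 :+ P :* (z :* :con 0)) := x :+ z) refl x z (ι p)) x+z≈1
  x+z≈1⇒x^pᵇ+z^pᵇ≈1 {p} pp {x} {z} x+z≈1 (suc b)
    with h , eq ← x+z≈1⇒x^pᵇ+z^pᵇ≈1 pp x+z≈1 b
    with s , frob ← frobenius pp (x ^ (p ℕ.^ b)) (z ^ (p ℕ.^ b) + ι p * (z * h))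
    with k , quot ← ^-+-quotient p (z ^ (p ℕ.^ b)) (ι p * (z * h))
    = j * u + h * k , (begin
      x ^ (p ℕ.* q) + (z ^ (p ℕ.* q) + ι p * (z * (j * u + h * k)))
        ≈⟨ +-cong (^-*-comm x) (+-congʳ (^-*-comm z)) ⟩
      (x ^ q) ^ p + ((z ^ q) ^ p + ι p * (z * (j * u + h * k)))
        ≈⟨ solve 8 (λ x^ z^ P z j u h k → x^ :+ (z^ :+ P :* (z :* (j :* u :+ h :* k)))
                     := x^ :+ P :* ((z :* j) :* u) :+ (z^ :+ (P :* (z :* h)) :* k))
             refl ((x ^ q) ^ p) ((z ^ q) ^ p) (ι p) z j u h k ⟩
      (x ^ q) ^ p + ι p * ((z * j) * u) + ((z ^ q) ^ p + (ι p * (z * h)) * k)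
        ≈⟨ +-cong (+-congˡ (*-congˡ (*-congʳ w≈z*j))) quot ⟨
      (x ^ q) ^ p + ι p * (w * u) + w ^ p
        ≈⟨ frob ⟨
      (x ^ q + w) ^ p
        ≈⟨ ^-congˡ p eq ⟩
      1# ^ p
        ≈⟨ 1^n≈1 p ⟩
      1# ∎)
    where
    q : ℕ
    q = p ℕ.^ b
    instance
      q≢0 : ℕ.NonZero q
      q≢0 = ℕ.m^n≢0 p b {{prime⇒nonZero pp}}
    w u j : Carrier
    w = z ^ q + ι p * (z * h)
    u = (x ^ q) ^ (p ℕ.∸ 1) + w * s
    j = z ^ (q ℕ.∸ 1) + ι p * h
    w≈z*j : w ≈ z * j
    w≈z*j = trans (+-congʳ (x^n≈x*x^[n∸1] z q))
      (solve 4 (λ z z^ P h → z :* z^ :+ P :* (z :* h) := z :* (z^ :+ P :* h)) refl z (z ^ (q ℕ.∸ 1)) (ι p) h)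
    ^-*-comm : ∀ x → x ^ (p ℕ.* q) ≈ (x ^ q) ^ p
    ^-*-comm x = trans (^-congʳ x (ℕ.*-comm p q)) (sym (^-assocʳ x q p))

-- Operators on integer sequences

-- Polynomials in the shift X are kept as syntax, which gives commutativity by induction; they are identified by their actions.
infixl 6 _⊕_
infixl 7 _⊗_
data Op : Set where
  con     : ℤ → Op
  X       : Op
  _⊕_ _⊗_ : Op → Op → Op

⟦_⟧ : Op → (ℤ → ℤ) → ℤ → ℤ
⟦ con a ⟧ f s = a ℤ.* f s
⟦ X ⟧     f s = f (s ℤ.+ 1ℤ)
⟦ F ⊕ G ⟧ f s = ⟦ F ⟧ f s ℤ.+ ⟦ G ⟧ f s
⟦ F ⊗ G ⟧ f   = ⟦ F ⟧ (⟦ G ⟧ f)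

-- The value at X = 1, which is the factor by which a polynomial in the shift multiplies constants
-- (`mod-⟦⟧`).
aug : Op → ℤ
aug (con a) = a
aug X       = 1ℤ
aug (F ⊕ G) = aug F ℤ.+ aug G
aug (F ⊗ G) = aug F ℤ.* aug G

⟦⟧-ext : ∀ F {f g} → (∀ s → f s ≡ g s) → ∀ s → ⟦ F ⟧ f s ≡ ⟦ F ⟧ g s
⟦⟧-ext (con a) f≡g s = ≡.cong (a ℤ.*_) (f≡g s)
⟦⟧-ext X       f≡g s = f≡g (s ℤ.+ 1ℤ)
⟦⟧-ext (F ⊕ G) f≡g s = ≡.cong₂ ℤ._+_ (⟦⟧-ext F f≡g s) (⟦⟧-ext G f≡g s)
⟦⟧-ext (F ⊗ G) f≡g s = ⟦⟧-ext F (⟦⟧-ext G f≡g) s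

⟦⟧-* : ∀ F a f s → ⟦ F ⟧ (λ t → a ℤ.* f t) s ≡ a ℤ.* ⟦ F ⟧ f s
⟦⟧-* (con b) a f s = swap b a (f s)
  where
  swap : ∀ b a x → b ℤ.* (a ℤ.* x) ≡ a ℤ.* (b ℤ.* x)
  swap = ℤ-Tactic.solve-∀
⟦⟧-* X       a f s = ≡.refl
⟦⟧-* (F ⊕ G) a f s = ≡.trans (≡.cong₂ ℤ._+_ (⟦⟧-* F a f s) (⟦⟧-* G a f s)) (≡.sym (ℤ.*-distribˡ-+ a _ _))
⟦⟧-* (F ⊗ G) a f s = ≡.trans (⟦⟧-ext F (⟦⟧-* G a f) s) (⟦⟧-* F a (⟦ G ⟧ f) s)

⟦⟧-+ : ∀ F f g s → ⟦ F ⟧ (λ t → f t ℤ.+ g t) s ≡ ⟦ F ⟧ f s ℤ.+ ⟦ F ⟧ g s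
⟦⟧-+ (con a) f g s = ℤ.*-distribˡ-+ a (f s) (g s)
⟦⟧-+ X       f g s = ≡.refl
⟦⟧-+ (F ⊕ G) f g s = ≡.trans (≡.cong₂ ℤ._+_ (⟦⟧-+ F f g s) (⟦⟧-+ G f g s))
  (interchange (⟦ F ⟧ f s) (⟦ F ⟧ g s) (⟦ G ⟧ f s) (⟦ G ⟧ g s))
  where
  interchange : ∀ a b c d → (a ℤ.+ b) ℤ.+ (c ℤ.+ d) ≡ (a ℤ.+ c) ℤ.+ (b ℤ.+ d)
  interchange = ℤ-Tactic.solve-∀
⟦⟧-+ (F ⊗ G) f g s = ≡.trans (⟦⟧-ext F (⟦⟧-+ G f g) s) (⟦⟧-+ F (⟦ G ⟧ f) (⟦ G ⟧ g) s)

⟦⟧-shift : ∀ F f s → ⟦ F ⟧ (λ t → f (t ℤ.+ 1ℤ)) s ≡ ⟦ F ⟧ f (s ℤ.+ 1ℤ)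
⟦⟧-shift (con a) f s = ≡.refl
⟦⟧-shift X       f s = ≡.refl
⟦⟧-shift (F ⊕ G) f s = ≡.cong₂ ℤ._+_ (⟦⟧-shift F f s) (⟦⟧-shift G f s)
⟦⟧-shift (F ⊗ G) f s = ≡.trans (⟦⟧-ext F (⟦⟧-shift G f) s) (⟦⟧-shift F (⟦ G ⟧ f) s)

⟦⟧-comm : ∀ F G f s → ⟦ F ⟧ (⟦ G ⟧ f) s ≡ ⟦ G ⟧ (⟦ F ⟧ f) s
⟦⟧-comm F (con a) f s = ⟦⟧-* F a f s
⟦⟧-comm F X       f s = ⟦⟧-shift F f s
⟦⟧-comm F (G ⊕ H) f s = ≡.trans (⟦⟧-+ F (⟦ G ⟧ f) (⟦ H ⟧ f) s) (≡.cong₂ ℤ._+_ (⟦⟧-comm F G f s) (⟦⟧-comm F H f s))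
⟦⟧-comm F (G ⊗ H) f s = ≡.trans (⟦⟧-comm F G (⟦ H ⟧ f) s) (⟦⟧-ext G (⟦⟧-comm F H f) s)

infix 4 _≋_
record _≋_ (F G : Op) : Set where
  constructor mk≋
  field action : ∀ f s → ⟦ F ⟧ f s ≡ ⟦ G ⟧ f s
open _≋_ public

Op-commutativeSemiring : CommutativeSemiring 0ℓ 0ℓ
Op-commutativeSemiring = record
  { Carrier = Op ; _≈_ = _≋_ ; _+_ = _⊕_ ; _*_ = _⊗_ ; 0# = con 0ℤ ; 1# = con 1ℤ
  ; isCommutativeSemiring = record
    { isSemiring = record
      { isSemiringWithoutAnnihilatingZero = record
        { +-isCommutativeMonoid = record
          { isMonoid = record
            { isSemigroup = record
              { isMagma = record
                { isEquivalence = record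
                  { refl  = mk≋ λ f s → ≡.refl
                  ; sym   = λ p → mk≋ λ f s → ≡.sym (action p f s)
                  ; trans = λ p q → mk≋ λ f s → ≡.trans (action p f s) (action q f s)
                  }
                ; ∙-cong = λ p q → mk≋ λ f s → ≡.cong₂ ℤ._+_ (action p f s) (action q f s)
                }
              ; assoc = λ F G H → mk≋ λ f s → ℤ.+-assoc (⟦ F ⟧ f s) (⟦ G ⟧ f s) (⟦ H ⟧ f s)
              }
            ; identity = (λ F → mk≋ λ f s → ℤ.+-identityˡ _) , (λ F → mk≋ λ f s → ℤ.+-identityʳ _)
            }
          ; comm = λ F G → mk≋ λ f s → ℤ.+-comm (⟦ F ⟧ f s) (⟦ G ⟧ f s)
          }
        ; *-cong = λ {F} {F′} {G} {G′} p q → mk≋ λ f s → ≡.trans (⟦⟧-ext F (action q f) s) (action p (⟦ G′ ⟧ f) s)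
        ; *-assoc = λ F G H → mk≋ λ f s → ≡.refl
        ; *-identity = (λ F → mk≋ λ f s → ℤ.*-identityˡ _)
                     , (λ F → mk≋ λ f s → ⟦⟧-ext F (λ t → ℤ.*-identityˡ (f t)) s)
        ; distrib = (λ F G H → mk≋ λ f s → ⟦⟧-+ F (⟦ G ⟧ f) (⟦ H ⟧ f) s)
                  , (λ F G H → mk≋ λ f s → ≡.refl)
        }
      ; zero = (λ F → mk≋ λ f s → ≡.refl)
             , (λ F → mk≋ λ f s → ⟦⟧-* F 0ℤ f s)
      }
    ; *-comm = λ F G → mk≋ (⟦⟧-comm F G)
    }
  }

open CommutativeSemiringLemmas Op-commutativeSemiring
open CommutativeSemiring Op-commutativeSemiring
  using (semiring; setoid; +-assoc; +-cong; +-congʳ; *-congˡ)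
  renaming (refl to ≋-refl; sym to ≋-sym; trans to ≋-trans)
open import Algebra.Properties.Semiring.Exp semiring
  using (^-homo-*; ^-assocʳ; ^-congˡ; ^-congʳ) renaming (_^_ to _^ᵒ_)

⟦ι⟧ : ∀ n f s → ⟦ ι n ⟧ f s ≡ + n ℤ.* f s
⟦ι⟧ zero    f s = ≡.refl
⟦ι⟧ (suc n) f s = ≡.trans (≡.cong (λ x → 1ℤ ℤ.* f s ℤ.+ x) (⟦ι⟧ n f s)) (≡.sym (ℤ.*-distribʳ-+ (f s) 1ℤ (+ n)))

⟦X^n⟧ : ∀ n f s → ⟦ X ^ᵒ n ⟧ f s ≡ f (s ℤ.+ + n)
⟦X^n⟧ zero    f s = ≡.trans (ℤ.*-identityˡ (f s)) (≡.cong f (≡.sym (ℤ.+-identityʳ s)))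
⟦X^n⟧ (suc n) f s = ≡.trans (⟦X^n⟧ n f (s ℤ.+ 1ℤ)) (≡.cong f (ℤ.+-assoc s 1ℤ (+ n)))

aug-1^n : ∀ {F} n → aug F ≡ 1ℤ → aug (F ^ᵒ n) ≡ 1ℤ
aug-1^n zero    aug≡1 = ≡.refl
aug-1^n (suc n) aug≡1 = ≡.cong₂ ℤ._*_ aug≡1 (aug-1^n n aug≡1)

-- Sequences congruent to a constant

infix 4 _≡_[mod_]
record _≡_[mod_] (f : ℤ → ℤ) (c : ℤ) (d : ℕ) : Set where
  constructor mkmod
  field at : ∀ s → + d ∣ᶻ f s ℤ.- c
open _≡_[mod_] public

mod1 : ∀ f c → f ≡ c [mod 1 ]
mod1 f c = mkmod λ s → ℤ∣.divides (f s ℤ.- c) (≡.sym (ℤ.*-identityʳ _))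

mod-cong : ∀ {d c c′ f g} → (∀ s → f s ≡ g s) → c ≡ c′ → g ≡ c [mod d ] → f ≡ c′ [mod d ]
mod-cong {d} f≡g ≡.refl g≡c = mkmod λ s → ≡.subst (λ x → + d ∣ᶻ x ℤ.- _) (≡.sym (f≡g s)) (at g≡c s)

mod-+ : ∀ {d a b f g} → f ≡ a [mod d ] → g ≡ b [mod d ] → (λ s → f s ℤ.+ g s) ≡ a ℤ.+ b [mod d ]
mod-+ {a = a} {b} {f} {g} f≡a g≡b = mkmod λ s →
  ≡.subst (_ ∣ᶻ_) (rearrange (f s) (g s) a b) (ℤ∣.∣m∣n⇒∣m+n (at f≡a s) (at g≡b s))
  where
  rearrange : ∀ x y a b → (x ℤ.- a) ℤ.+ (y ℤ.- b) ≡ (x ℤ.+ y) ℤ.- (a ℤ.+ b)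
  rearrange = ℤ-Tactic.solve-∀

*-distrib-- : ∀ a x y → a ℤ.* (x ℤ.- y) ≡ a ℤ.* x ℤ.- a ℤ.* y
*-distrib-- = ℤ-Tactic.solve-∀

mod-* : ∀ {d c f} a → f ≡ c [mod d ] → (λ s → a ℤ.* f s) ≡ a ℤ.* c [mod d ]
mod-* {c = c} {f} a f≡c = mkmod λ s → ≡.subst (_ ∣ᶻ_) (*-distrib-- a (f s) c) (ℤ∣.∣n⇒∣m*n a (at f≡c s))

-- Unlike in `mod-*`, the modulus grows with the factor; each recursion step gains its power of p
-- here.
mod-scale : ∀ {d c f} m → f ≡ c [mod d ] → (λ s → + m ℤ.* f s) ≡ + m ℤ.* c [mod m ℕ.* d ]
mod-scale {d} {c} {f} m f≡c = mkmod λ s →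
  ≡.subst₂ _∣ᶻ_ (≡.sym (ℤ.pos-* m d)) (*-distrib-- (+ m) (f s) c) (ℤ∣.*-monoʳ-∣ (+ m) (at f≡c s))

mod-⟦⟧ : ∀ {d c f} F → f ≡ c [mod d ] → ⟦ F ⟧ f ≡ aug F ℤ.* c [mod d ]
mod-⟦⟧ (con a) f≡c = mod-* a f≡c
mod-⟦⟧ {c = c} X f≡c = mod-cong (λ _ → ≡.refl) (≡.sym (ℤ.*-identityˡ c)) (mkmod λ s → at f≡c (s ℤ.+ 1ℤ))
mod-⟦⟧ {c = c} (F ⊕ G) f≡c = mod-cong (λ _ → ≡.refl) (≡.sym (ℤ.*-distribʳ-+ c (aug F) (aug G))) (mod-+ (mod-⟦⟧ F f≡c) (mod-⟦⟧ G f≡c))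
mod-⟦⟧ {c = c} (F ⊗ G) f≡c = mod-cong (λ _ → ≡.refl) (≡.sym (ℤ.*-assoc (aug F) (aug G) c)) (mod-⟦⟧ F (mod-⟦⟧ G f≡c))

mod-⟦⟧₀ : ∀ {d f} F → f ≡ 0ℤ [mod d ] → ⟦ F ⟧ f ≡ 0ℤ [mod d ]
mod-⟦⟧₀ F f≡0 = mod-cong (λ _ → ≡.refl) (ℤ.*-zeroʳ (aug F)) (mod-⟦⟧ F f≡0)

z : Op
z = con 1ℤ ⊕ (con -1ℤ ⊗ X)

X+z≋1 : X ⊕ z ≋ con 1ℤ
X+z≋1 = mk≋ λ f s → cancel (f (s ℤ.+ 1ℤ)) (f s)
  where
  cancel : ∀ x y → x ℤ.+ (1ℤ ℤ.* y ℤ.+ -1ℤ ℤ.* x) ≡ 1ℤ ℤ.* y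
  cancel = ℤ-Tactic.solve-∀

-- `z` takes the difference of neighbours, so the congruence with f 0 spreads from 0 in both
-- directions.
mod-constant : ∀ {d f} → ⟦ z ⟧ f ≡ 0ℤ [mod d ] → f ≡ f 0ℤ [mod d ]
mod-constant {d} {f} zf≡0 = mkmod go
  where
  telescope : ∀ a b c → (a ℤ.- c) ℤ.- ((1ℤ ℤ.* a ℤ.+ -1ℤ ℤ.* b) ℤ.- 0ℤ) ≡ b ℤ.- c
  telescope = ℤ-Tactic.solve-∀
  telescope′ : ∀ a b c → (b ℤ.- c) ℤ.+ ((1ℤ ℤ.* a ℤ.+ -1ℤ ℤ.* b) ℤ.- 0ℤ) ≡ a ℤ.- c
  telescope′ = ℤ-Tactic.solve-∀
  up : ∀ s → + d ∣ᶻ f s ℤ.- f 0ℤ → + d ∣ᶻ f (s ℤ.+ 1ℤ) ℤ.- f 0ℤ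
  up s d∣ = ≡.subst (+ d ∣ᶻ_) (telescope (f s) (f (s ℤ.+ 1ℤ)) (f 0ℤ)) (ℤ∣.∣m∣n⇒∣m-n d∣ (at zf≡0 s))
  down : ∀ s → + d ∣ᶻ f (s ℤ.+ 1ℤ) ℤ.- f 0ℤ → + d ∣ᶻ f s ℤ.- f 0ℤ
  down s d∣ = ≡.subst (+ d ∣ᶻ_) (telescope′ (f s) (f (s ℤ.+ 1ℤ)) (f 0ℤ)) (ℤ∣.∣m∣n⇒∣m+n d∣ (at zf≡0 s))
  go : ∀ s → + d ∣ᶻ f s ℤ.- f 0ℤ
  go (+ zero)      = ℤ∣.divides 0ℤ (ℤ.+-inverseʳ (f 0ℤ))
  go (+ suc n)     = ≡.subst (λ t → + d ∣ᶻ f t ℤ.- f 0ℤ) (≡.cong +_ (ℕ.+-comm n 1)) (up (+ n) (go (+ n)))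
  go -[1+ zero ]   = down -[1+ zero ] (go (+ zero))
  go -[1+ suc n ]  = down -[1+ suc n ] (go -[1+ n ])

-- Integer binomial coefficients and the sequences `δ`

binomialℤ : ℤ → ℕ → ℤ
binomialℤ _            zero    = 1ℤ
binomialℤ (+ zero)     (suc l) = 0ℤ
binomialℤ (+ suc n)    (suc l) = binomialℤ (+ n) (suc l) ℤ.+ binomialℤ (+ n) l
-- For negative x Pascal's rule is solved as C(x, l+1) = C(x+1, l+1) - C(x, l); at x = -1 the first
-- term is C(0, l+1) = 0.
binomialℤ -[1+ zero  ] (suc l) = 0ℤ ℤ.- binomialℤ -[1+ zero ] l
binomialℤ -[1+ suc n ] (suc l) = binomialℤ -[1+ n ] (suc l) ℤ.- binomialℤ -[1+ suc n ] l

a-b+b≡a : ∀ a b → a ℤ.- b ℤ.+ b ≡ a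
a-b+b≡a = ℤ-Tactic.solve-∀

binomialℤ-pascal : ∀ x l → binomialℤ (ℤ.suc x) (suc l) ≡ binomialℤ x (suc l) ℤ.+ binomialℤ x l
binomialℤ-pascal (+ n)         l = ≡.refl
binomialℤ-pascal -[1+ zero  ]  l = ≡.sym (a-b+b≡a 0ℤ (binomialℤ -[1+ zero ] l))
binomialℤ-pascal -[1+ suc n ]  l = ≡.sym (a-b+b≡a (binomialℤ -[1+ n ] (suc l)) (binomialℤ -[1+ suc n ] l))

module _ (q : ℕ) .{{q≢0 : ℕ.NonZero q}} where

  δ : ℕ → ℤ → ℤ
  δ l s with + q ℤ∣.∣? s
  ... | yes q∣s = binomialℤ (ℤ∣.quotient q∣s) l
  ... | no  _   = 0ℤ

  δ-multiple : ∀ l j → δ l (j ℤ.* + q) ≡ binomialℤ j l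
  δ-multiple l j with + q ℤ∣.∣? (j ℤ.* + q)
  ... | yes (ℤ∣.divides i eq) = ≡.cong (λ x → binomialℤ x l) (≡.sym (ℤ.*-cancelʳ-≡ j i (+ q) eq))
  ... | no  q∤               = ⊥-elim (q∤ (ℤ∣.divides j ≡.refl))

  δ-nonmultiple : ∀ l {s} → ¬ + q ∣ᶻ s → δ l s ≡ 0ℤ
  δ-nonmultiple l {s} q∤s with + q ℤ∣.∣? s
  ... | yes q∣s = ⊥-elim (q∤s q∣s)
  ... | no  _   = ≡.refl

  q∤s⇒q∤s+q : ∀ {s} → ¬ + q ∣ᶻ s → ¬ + q ∣ᶻ s ℤ.+ + q
  q∤s⇒q∤s+q q∤s q∣s+q = q∤s (ℤ∣.∣m+n∣n⇒∣m q∣s+q ℤ∣.∣-refl)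

  j*q+q : ∀ j → j ℤ.* + q ℤ.+ + q ≡ ℤ.suc j ℤ.* + q
  j*q+q j = ≡.trans (ℤ.+-comm (j ℤ.* + q) (+ q)) (≡.sym (ℤ.suc-* j (+ q)))

  δ-shift-zero : ∀ s → δ 0 (s ℤ.+ + q) ≡ δ 0 s
  δ-shift-zero s with + q ℤ∣.∣? s
  ... | yes (ℤ∣.divides j ≡.refl) = ≡.trans (≡.cong (δ 0) (j*q+q j)) (δ-multiple 0 (ℤ.suc j))
  ... | no  q∤s = δ-nonmultiple 0 (q∤s⇒q∤s+q q∤s)

  δ-shift-suc : ∀ l s → δ (suc l) (s ℤ.+ + q) ≡ δ (suc l) s ℤ.+ δ l s
  δ-shift-suc l s with + q ℤ∣.∣? s
  ... | yes (ℤ∣.divides j ≡.refl) =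
    ≡.trans (≡.cong (δ (suc l)) (j*q+q j)) (≡.trans (δ-multiple (suc l) (ℤ.suc j)) (binomialℤ-pascal j l))
  ... | no  q∤s = δ-nonmultiple (suc l) (q∤s⇒q∤s+q q∤s)

  0<i<q⇒δ≡0 : ∀ l {i} → 0 ℕ.< i → i ℕ.< q → δ l (+ i) ≡ 0ℤ
  0<i<q⇒δ≡0 l {i} 0<i i<q = δ-nonmultiple l
    (λ q∣i → ℕ.<⇒≱ i<q (ℕ.∣⇒≤ {{ℕ.>-nonZero 0<i}} (ℤ∣.∣⇒∣ᵤ q∣i)))

  -- z^n at i reads only the entries from i to i + n, and none of these is at a multiple of q.
  ⟦z^n⟧δ-vanishes : ∀ n {i} → 0 ℕ.< i → i ℕ.+ n ℕ.< q → ⟦ z ^ᵒ n ⟧ (δ 0) (+ i) ≡ 0ℤ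
  ⟦z^n⟧δ-vanishes zero    {i} 0<i i+n<q = ≡.cong (1ℤ ℤ.*_) (0<i<q⇒δ≡0 0 0<i (≡.subst (ℕ._< q) (ℕ.+-identityʳ i) i+n<q))
  ⟦z^n⟧δ-vanishes (suc n) {i} 0<i i+n<q = ≡.cong₂ (λ a b → 1ℤ ℤ.* a ℤ.+ -1ℤ ℤ.* b)
    (⟦z^n⟧δ-vanishes n 0<i (ℕ.<-trans (ℕ.+-monoʳ-< i (ℕ.n<1+n n)) i+n<q))
    (⟦z^n⟧δ-vanishes n {i ℕ.+ 1} (ℕ.m≤n⇒m≤n+o 1 0<i) (≡.subst (ℕ._< q) (≡.sym (ℕ.+-assoc i 1 n)) i+n<q))

  ⟦z^n⟧δ-zero : ∀ n → n ℕ.< q → ⟦ z ^ᵒ n ⟧ (δ 0) 0ℤ ≡ 1ℤ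
  ⟦z^n⟧δ-zero zero    n<q = ≡.cong (1ℤ ℤ.*_) (δ-multiple 0 0ℤ)
  ⟦z^n⟧δ-zero (suc n) n<q = ≡.cong₂ (λ a b → 1ℤ ℤ.* a ℤ.+ -1ℤ ℤ.* b)
    (⟦z^n⟧δ-zero n (ℕ.<-trans (ℕ.n<1+n n) n<q)) (⟦z^n⟧δ-vanishes n (s≤s z≤n) n<q)

-- The congruence for ⟦ z ^ᵒ n ⟧

pascal-induction : (A : ℕ → ℕ → Set) → A 0 0 → (∀ l → A 0 (suc l)) → (∀ m → A m 0 → A (suc m) 0) →
  (∀ m l → A m l → A m (suc l) → A (suc m) (suc l)) → ∀ m l → A m l
pascal-induction A c00 c0s cs0 css zero    zero    = c00
pascal-induction A c00 c0s cs0 css zero    (suc l) = c0s l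
pascal-induction A c00 c0s cs0 css (suc m) zero    = cs0 m (pascal-induction A c00 c0s cs0 css m 0)
pascal-induction A c00 c0s cs0 css (suc m) (suc l) =
  css m l (pascal-induction A c00 c0s cs0 css m l) (pascal-induction A c00 c0s cs0 css m (suc l))

module Congruence (r′ : ℕ) (p-prime : Prime (suc (suc r′))) (b : ℕ) where

  open import Algebra.Solver.Ring.NaturalCoefficients.Default Op-commutativeSemiring
    using (solve; _:+_; _:*_; _:=_) renaming (con to :con)

  p r Q q : ℕ
  p = suc (suc r′)
  r = suc r′
  Q = p ℕ.^ b
  q = p ℕ.^ suc b

  instance
    Q≢0 : ℕ.NonZero Q
    Q≢0 = ℕ.m^n≢0 p b
    q≢0 : ℕ.NonZero q
    q≢0 = ℕ.m^n≢0 p (suc b)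

  h : Op
  h = proj₁ (x+z≈1⇒x^pᵇ+z^pᵇ≈1 p-prime X+z≋1 b)

  w : Op
  w = z ^ᵒ Q ⊕ ι p ⊗ (z ⊗ h)

  X^Q+w≋1 : X ^ᵒ Q ⊕ w ≋ con 1ℤ
  X^Q+w≋1 = proj₂ (x+z≈1⇒x^pᵇ+z^pᵇ≈1 p-prime X+z≋1 b)

  u W : Op
  u = (X ^ᵒ Q) ^ᵒ (p ℕ.∸ 1) ⊕ w ⊗ proj₁ (frobenius p-prime (X ^ᵒ Q) w)
  W = ι p ⊗ (w ⊗ u) ⊕ w ^ᵒ p

  X^q+W≋1 : X ^ᵒ q ⊕ W ≋ con 1ℤ
  X^q+W≋1 = begin
    X ^ᵒ q ⊕ W               ≈⟨ +-congʳ (≋-trans (^-congʳ X (ℕ.*-comm p Q)) (≋-sym (^-assocʳ X Q p))) ⟩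
    (X ^ᵒ Q) ^ᵒ p ⊕ W         ≈⟨ +-assoc ((X ^ᵒ Q) ^ᵒ p) (ι p ⊗ (w ⊗ u)) (w ^ᵒ p) ⟨
    ((X ^ᵒ Q) ^ᵒ p ⊕ ι p ⊗ (w ⊗ u)) ⊕ w ^ᵒ p ≈⟨ proj₂ (frobenius p-prime (X ^ᵒ Q) w) ⟨
    (X ^ᵒ Q ⊕ w) ^ᵒ p         ≈⟨ ^-congˡ p X^Q+w≋1 ⟩
    con 1ℤ ^ᵒ p              ≈⟨ 1^n≈1 p ⟩
    con 1ℤ                  ∎
    where open import Relation.Binary.Reasoning.Setoid setoid

  aug-z^n : ∀ n .{{_ : ℕ.NonZero n}} → aug (z ^ᵒ n) ≡ 0ℤ
  aug-z^n (suc n) = ≡.refl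

  aug-w : aug w ≡ 0ℤ
  aug-w = ≡.cong₂ ℤ._+_ (aug-z^n Q) (ℤ.*-zeroʳ (aug (ι p)))

  -- At X = 1 the power of X becomes 1 and `w` becomes 0, whatever its cofactor is. This is the use
  -- of isolating x^(p-1) in `frobenius`.
  aug-u : aug u ≡ 1ℤ
  aug-u = ≡.cong₂ (λ x y → x ℤ.+ y ℤ.* aug (proj₁ (frobenius p-prime (X ^ᵒ Q) w)))
    (aug-1^n {X ^ᵒ Q} (p ℕ.∸ 1) (aug-1^n {X} Q ≡.refl)) aug-w

  -- The factor p ^ l turns the moduli p ^ (m ∸ l) into p ^ m, avoiding truncated subtraction.
  δ̃ : ℕ → ℤ → ℤ
  δ̃ l s = + (p ℕ.^ l) ℤ.* δ q l s

  ⟦W⟧ : ∀ f s → ⟦ W ⟧ f s ≡ f s ℤ.- f (s ℤ.+ + q)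
  ⟦W⟧ f s = ≡.trans (subtract (⟦ X ^ᵒ q ⟧ f s) (⟦ W ⟧ f s))
    (≡.cong₂ ℤ._-_ (≡.trans (action X^q+W≋1 f s) (ℤ.*-identityˡ (f s))) (⟦X^n⟧ q f s))
    where
    subtract : ∀ x y → y ≡ (x ℤ.+ y) ℤ.- x
    subtract = ℤ-Tactic.solve-∀

  ⟦W⟧δ̃-zero : ∀ s → ⟦ W ⟧ (δ̃ 0) s ≡ 0ℤ
  ⟦W⟧δ̃-zero s = ≡.trans (⟦W⟧ (δ̃ 0) s)
    (≡.trans (≡.cong (λ x → δ̃ 0 s ℤ.- 1ℤ ℤ.* x) (δ-shift-zero q s)) (ℤ.+-inverseʳ (δ̃ 0 s)))

  -- The difference over a step q is -δ l, and passing from the scale p^(l+1) to p^l releases one p.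
  ⟦W⟧δ̃-suc : ∀ l s → ⟦ W ⟧ (δ̃ (suc l)) s ≡ -1ℤ ℤ.* (+ p ℤ.* δ̃ l s)
  ⟦W⟧δ̃-suc l s = ≡.trans (⟦W⟧ (δ̃ (suc l)) s) (≡.trans
    (≡.cong (λ x → δ̃ (suc l) s ℤ.- + (p ℕ.^ suc l) ℤ.* x) (δ-shift-suc q l s))
    (≡.trans (≡.cong (λ c → c ℤ.* δ q (suc l) s ℤ.- c ℤ.* (δ q (suc l) s ℤ.+ δ q l s)) (ℤ.pos-* p (p ℕ.^ l)))
      (cancel (+ p) (+ (p ℕ.^ l)) (δ q (suc l) s) (δ q l s))))
    where
    cancel : ∀ P c x y → (P ℤ.* c) ℤ.* x ℤ.- (P ℤ.* c) ℤ.* (x ℤ.+ y) ≡ -1ℤ ℤ.* (P ℤ.* (c ℤ.* y))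
    cancel = ℤ-Tactic.solve-∀

  opaque
    -- For n = Q - 1 + Q N this is z^n with every z^Q replaced by `w`, taking e = N. It is opaque so
    -- that `E e` stays one atom.
    E : ℕ → Op
    E e = z ^ᵒ (Q ℕ.∸ 1) ⊗ w ^ᵒ e

    E-def : ∀ e → E e ≋ z ^ᵒ (Q ℕ.∸ 1) ⊗ w ^ᵒ e
    E-def e = ≋-refl

  E-split : ∀ i j → E (i ℕ.+ j) ≋ w ^ᵒ i ⊗ E j
  E-split i j = begin
    E (i ℕ.+ j)                            ≈⟨ E-def (i ℕ.+ j) ⟩
    z ^ᵒ (Q ℕ.∸ 1) ⊗ w ^ᵒ (i ℕ.+ j)          ≈⟨ *-congˡ (^-homo-* w i j) ⟩
    z ^ᵒ (Q ℕ.∸ 1) ⊗ (w ^ᵒ i ⊗ w ^ᵒ j)        ≈⟨ solve 3 (λ x y z → x :* (y :* z) := y :* (x :* z)) ≋-refl (z ^ᵒ (Q ℕ.∸ 1)) (w ^ᵒ i) (w ^ᵒ j) ⟩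
    w ^ᵒ i ⊗ (z ^ᵒ (Q ℕ.∸ 1) ⊗ w ^ᵒ j)        ≈⟨ *-congˡ (E-def j) ⟨
    w ^ᵒ i ⊗ E j                            ∎
    where open import Relation.Binary.Reasoning.Setoid setoid

  -- Here w^p is replaced by W - p w u. Either all p factors `w` are spent on `W`, or p - 1 of them
  -- are spent on -p u and one survives.
  ⟦E⟧-reduce : ∀ e f s → ⟦ E (p ℕ.+ e) ⟧ f s ≡ ⟦ E e ⟧ (⟦ W ⟧ f) s ℤ.+ -1ℤ ℤ.* (+ p ℤ.* ⟦ u ⟧ (⟦ E (suc e) ⟧ f) s)
  ⟦E⟧-reduce e f s = ≡.trans (subtract _ _)
    (≡.cong₂ (λ x y → x ℤ.+ -1ℤ ℤ.* y) (action identity f s) (⟦ι⟧ p (⟦ u ⟧ (⟦ E (suc e) ⟧ f)) s))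
    where
    subtract : ∀ x y → x ≡ (x ℤ.+ y) ℤ.+ -1ℤ ℤ.* y
    subtract = ℤ-Tactic.solve-∀
    identity : E (p ℕ.+ e) ⊕ ι p ⊗ (u ⊗ E (suc e)) ≋ E e ⊗ W
    identity = ≋-trans (+-cong (E-split p e) (*-congˡ (*-congˡ (E-split 1 e))))
      (solve 5 (λ w^p P u w k → w^p :* k :+ P :* (u :* ((w :* :con 1) :* k)) := k :* (P :* (w :* u) :+ w^p))
         ≋-refl (w ^ᵒ p) (ι p) u w (E e))

  -- The expected main term (-1)^m C(m, l) p^(m-l) of z^n δ l, multiplied by the scale p^l of `δ̃`.
  leading : ℕ → ℕ → ℤ
  leading m l = -1ℤ ℤ.^ m ℤ.* (+ (m C l) ℤ.* + (p ℕ.^ m))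

  leading-pascal : ∀ m l → -1ℤ ℤ.* (+ p ℤ.* leading m l) ℤ.+ -1ℤ ℤ.* (+ p ℤ.* leading m (suc l)) ≡ leading (suc m) (suc l)
  leading-pascal m l = ≡.trans
    (collect (-1ℤ ℤ.^ m) (+ (m C l)) (+ (m C suc l)) (+ p) (+ (p ℕ.^ m)))
    (≡.cong₂ (λ x c → -1ℤ ℤ.^ suc m ℤ.* (+ x ℤ.* c)) (nCk+nC[k+1]≡[n+1]C[k+1] m l) (≡.sym (ℤ.pos-* p (p ℕ.^ m))))
    where
    collect : ∀ ε x y P c → -1ℤ ℤ.* (P ℤ.* (ε ℤ.* (x ℤ.* c))) ℤ.+ -1ℤ ℤ.* (P ℤ.* (ε ℤ.* (y ℤ.* c)))
      ≡ (-1ℤ ℤ.* ε) ℤ.* ((x ℤ.+ y) ℤ.* (P ℤ.* c))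
    collect = ℤ-Tactic.solve-∀

  leading-zero : ∀ m → 0ℤ ℤ.+ -1ℤ ℤ.* (+ p ℤ.* leading m 0) ≡ leading (suc m) 0
  leading-zero m = ≡.trans
    (collect (-1ℤ ℤ.^ m) (+ p) (+ (p ℕ.^ m)))
    (≡.cong (λ c → -1ℤ ℤ.^ suc m ℤ.* (1ℤ ℤ.* c)) (≡.sym (ℤ.pos-* p (p ℕ.^ m))))
    where
    collect : ∀ ε P c → 0ℤ ℤ.+ -1ℤ ℤ.* (P ℤ.* (ε ℤ.* (1ℤ ℤ.* c))) ≡ (-1ℤ ℤ.* ε) ℤ.* (1ℤ ℤ.* (P ℤ.* c))
    collect = ℤ-Tactic.solve-∀

  mod-⟦u⟧ : ∀ {d c f} → f ≡ c [mod d ] → (λ s → -1ℤ ℤ.* (+ p ℤ.* ⟦ u ⟧ f s)) ≡ -1ℤ ℤ.* (+ p ℤ.* c) [mod p ℕ.* d ]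
  mod-⟦u⟧ {c = c} f≡c = mod-* -1ℤ (mod-scale p (mod-cong (λ _ → ≡.refl)
    (≡.trans (≡.cong (ℤ._* c) aug-u) (ℤ.*-identityˡ c)) (mod-⟦⟧ u f≡c)))

  -- Modulo p, z^q agrees with 1 - X^q, which annihilates the q-periodic δ 0. So z kills z^(q-1) δ
  -- 0, which is therefore constant modulo p, and its value at 0 is 1 because only the entry at 0 is
  -- nonzero among those read.
  ⟦z^[q-1]⟧δ̃-zero : ⟦ z ^ᵒ (q ℕ.∸ 1) ⟧ (δ̃ 0) ≡ 1ℤ [mod p ]
  ⟦z^[q-1]⟧δ̃-zero = mod-cong (λ _ → ≡.refl) value (mod-constant killed)
    where
    δ̃≡δ : ∀ s → δ̃ 0 s ≡ δ q 0 s
    δ̃≡δ s = ℤ.*-identityˡ (δ q 0 s)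
    value : ⟦ z ^ᵒ (q ℕ.∸ 1) ⟧ (δ̃ 0) 0ℤ ≡ 1ℤ
    value = ≡.trans (⟦⟧-ext (z ^ᵒ (q ℕ.∸ 1)) δ̃≡δ 0ℤ) (⟦z^n⟧δ-zero q (q ℕ.∸ 1) (ℕ.≤-reflexive (ℕ.suc-pred q)))
    h₁ : Op
    h₁ = proj₁ (x+z≈1⇒x^pᵇ+z^pᵇ≈1 p-prime X+z≋1 (suc b))
    X^q+z^q≋1 : X ^ᵒ q ⊕ (z ^ᵒ q ⊕ ι p ⊗ (z ⊗ h₁)) ≋ con 1ℤ
    X^q+z^q≋1 = proj₂ (x+z≈1⇒x^pᵇ+z^pᵇ≈1 p-prime X+z≋1 (suc b))
    isolate : ∀ x y a c → x ≡ a → x ℤ.+ (y ℤ.+ c) ≡ 1ℤ ℤ.* a → y ℤ.- 0ℤ ≡ ℤ.- c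
    isolate x y .x c ≡.refl eq = ≡.trans (expand x y c) (≡.trans (≡.cong (λ t → t ℤ.- x ℤ.- c) eq) (collapse x c))
      where
      expand : ∀ x y c → y ℤ.- 0ℤ ≡ (x ℤ.+ (y ℤ.+ c)) ℤ.- x ℤ.- c
      expand = ℤ-Tactic.solve-∀
      collapse : ∀ x c → 1ℤ ℤ.* x ℤ.- x ℤ.- c ≡ ℤ.- c
      collapse = ℤ-Tactic.solve-∀
    killed : ⟦ z ⟧ (⟦ z ^ᵒ (q ℕ.∸ 1) ⟧ (δ̃ 0)) ≡ 0ℤ [mod p ]
    killed = mod-cong (λ s → ≡.sym (action (x^n≈x*x^[n∸1] z q) (δ̃ 0) s)) ≡.refl (mkmod λ s →
      ≡.subst (+ p ∣ᶻ_)
        (≡.sym (isolate (⟦ X ^ᵒ q ⟧ (δ̃ 0) s) (⟦ z ^ᵒ q ⟧ (δ̃ 0) s) (δ̃ 0 s) (⟦ ι p ⊗ (z ⊗ h₁) ⟧ (δ̃ 0) s)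
          (≡.trans (⟦X^n⟧ q (δ̃ 0) s) (≡.cong (1ℤ ℤ.*_) (δ-shift-zero q s)))
          (action X^q+z^q≋1 (δ̃ 0) s)))
        (ℤ∣.∣m⇒∣-m (≡.subst (+ p ∣ᶻ_) (≡.sym (⟦ι⟧ p (⟦ z ⊗ h₁ ⟧ (δ̃ 0)) s)) (ℤ∣.∣m⇒∣m*n (⟦ z ⊗ h₁ ⟧ (δ̃ 0) s) ℤ∣.∣-refl))))

  q-1 : (Q ℕ.∸ 1) ℕ.+ Q ℕ.* r ≡ q ℕ.∸ 1
  q-1 = ≡.trans (≡.sym (ℕ.+-∸-comm (Q ℕ.* r) (ℕ.>-nonZero⁻¹ Q)))
    (≡.cong (ℕ._∸ 1) (≡.trans (≡.sym (ℕ.*-suc Q r)) (ℕ.*-comm Q p)))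

  -- Modulo p the power w^(p-1) may be replaced by z^(Q(p-1)), and the exponents then add up to q -
  -- 1.
  ⟦E⟧δ̃-base : ⟦ E r ⟧ (δ̃ 0) ≡ 1ℤ [mod p ]
  ⟦E⟧δ̃-base = mod-cong (action identity (δ̃ 0)) ≡.refl
    (mod-+ {a = 1ℤ} {b = 0ℤ} ⟦z^[q-1]⟧δ̃-zero (mod-cong (⟦ι⟧ p f) ≡.refl
      (mkmod λ s → ≡.subst (+ p ∣ᶻ_) (≡.sym (ℤ.+-identityʳ _)) (ℤ∣.∣m⇒∣m*n (f s) ℤ∣.∣-refl))))
    where
    k : Op
    k = proj₁ (^-+-quotient r (z ^ᵒ Q) (ι p ⊗ (z ⊗ h)))
    f : ℤ → ℤ
    f = ⟦ z ^ᵒ (Q ℕ.∸ 1) ⊗ ((z ⊗ h) ⊗ k) ⟧ (δ̃ 0)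
    identity : E r ≋ z ^ᵒ (q ℕ.∸ 1) ⊕ ι p ⊗ (z ^ᵒ (Q ℕ.∸ 1) ⊗ ((z ⊗ h) ⊗ k))
    identity = begin
      E r ≈⟨ E-def r ⟩
      z ^ᵒ (Q ℕ.∸ 1) ⊗ w ^ᵒ r ≈⟨ *-congˡ (proj₂ (^-+-quotient r (z ^ᵒ Q) (ι p ⊗ (z ⊗ h)))) ⟩
      z ^ᵒ (Q ℕ.∸ 1) ⊗ ((z ^ᵒ Q) ^ᵒ r ⊕ (ι p ⊗ (z ⊗ h)) ⊗ k)
        ≈⟨ solve 5 (λ a b P c k → a :* (b :+ (P :* c) :* k) := a :* b :+ P :* (a :* (c :* k))) ≋-refl (z ^ᵒ (Q ℕ.∸ 1)) ((z ^ᵒ Q) ^ᵒ r) (ι p) (z ⊗ h) k ⟩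
      z ^ᵒ (Q ℕ.∸ 1) ⊗ (z ^ᵒ Q) ^ᵒ r ⊕ ι p ⊗ (z ^ᵒ (Q ℕ.∸ 1) ⊗ ((z ⊗ h) ⊗ k))
        ≈⟨ +-cong (*-congˡ (^-assocʳ z Q r)) ≋-refl ⟩
      z ^ᵒ (Q ℕ.∸ 1) ⊗ z ^ᵒ (Q ℕ.* r) ⊕ ι p ⊗ (z ^ᵒ (Q ℕ.∸ 1) ⊗ ((z ⊗ h) ⊗ k))
        ≈⟨ +-cong (^-homo-* z (Q ℕ.∸ 1) (Q ℕ.* r)) ≋-refl ⟨
      z ^ᵒ ((Q ℕ.∸ 1) ℕ.+ Q ℕ.* r) ⊕ ι p ⊗ (z ^ᵒ (Q ℕ.∸ 1) ⊗ ((z ⊗ h) ⊗ k))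
        ≈⟨ +-cong (^-congʳ z q-1) ≋-refl ⟩
      z ^ᵒ (q ℕ.∸ 1) ⊕ ι p ⊗ (z ^ᵒ (Q ℕ.∸ 1) ⊗ ((z ⊗ h) ⊗ k)) ∎
      where open import Relation.Binary.Reasoning.Setoid setoid

  -- The exponent l + (m+1)(p-1) is such that both terms of `⟦E⟧-reduce`, started in row m + 1, fall
  -- in row m.
  Claim : ℕ → ℕ → Set
  Claim m l = ⟦ E (l ℕ.+ suc m ℕ.* r) ⟧ (δ̃ l) ≡ leading m l [mod p ℕ.^ suc m ]

  claim-suc-zero : ∀ m → Claim m 0 → Claim (suc m) 0
  claim-suc-zero m ih = mod-cong pointwise (leading-zero m)
    (mod-+ {a = 0ℤ} {f = λ _ → 0ℤ} (mkmod λ s → ℤ∣.divides 0ℤ ≡.refl) (mod-⟦u⟧ ih))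
    where
    e : ℕ
    -- What remains after p factors are removed; `suc e` computes to (m+1) r, the exponent of the
    -- induction hypothesis.
    e = r′ ℕ.+ m ℕ.* r
    exponent : ∀ r′ m → suc (suc m) ℕ.* suc r′ ≡ suc (suc r′) ℕ.+ (r′ ℕ.+ m ℕ.* suc r′)
    exponent = ℕ-Tactic.solve-∀
    pointwise : ∀ s → ⟦ E (suc (suc m) ℕ.* r) ⟧ (δ̃ 0) s ≡ 0ℤ ℤ.+ -1ℤ ℤ.* (+ p ℤ.* ⟦ u ⟧ (⟦ E (suc m ℕ.* r) ⟧ (δ̃ 0)) s)
    pointwise s = begin
      ⟦ E (suc (suc m) ℕ.* r) ⟧ (δ̃ 0) s
        ≡⟨ ≡.cong (λ e → ⟦ E e ⟧ (δ̃ 0) s) (exponent r′ m) ⟩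
      ⟦ E (p ℕ.+ e) ⟧ (δ̃ 0) s
        ≡⟨ ⟦E⟧-reduce e (δ̃ 0) s ⟩
      ⟦ E e ⟧ (⟦ W ⟧ (δ̃ 0)) s ℤ.+ -1ℤ ℤ.* (+ p ℤ.* ⟦ u ⟧ (⟦ E (suc m ℕ.* r) ⟧ (δ̃ 0)) s)
        ≡⟨ ≡.cong (ℤ._+ -1ℤ ℤ.* (+ p ℤ.* ⟦ u ⟧ (⟦ E (suc m ℕ.* r) ⟧ (δ̃ 0)) s))
             (≡.trans (⟦⟧-ext (E e) ⟦W⟧δ̃-zero s) (⟦⟧-* (E e) 0ℤ (λ _ → 0ℤ) s)) ⟩
      0ℤ ℤ.+ -1ℤ ℤ.* (+ p ℤ.* ⟦ u ⟧ (⟦ E (suc m ℕ.* r) ⟧ (δ̃ 0)) s) ∎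
      where open ≡.≡-Reasoning

  claim-suc-suc : ∀ m l → Claim m l → Claim m (suc l) → Claim (suc m) (suc l)
  claim-suc-suc m l ih₁ ih₂ = mod-cong pointwise (leading-pascal m l)
    (mod-+ (mod-* -1ℤ (mod-scale p ih₁)) (mod-⟦u⟧ ih₂))
    where
    e : ℕ
    e = l ℕ.+ suc m ℕ.* r
    exponent : ∀ l r′ m → suc l ℕ.+ suc (suc m) ℕ.* suc r′ ≡ suc (suc r′) ℕ.+ (l ℕ.+ suc m ℕ.* suc r′)
    exponent = ℕ-Tactic.solve-∀
    pointwise : ∀ s → ⟦ E (suc l ℕ.+ suc (suc m) ℕ.* r) ⟧ (δ̃ (suc l)) s ≡
      -1ℤ ℤ.* (+ p ℤ.* ⟦ E e ⟧ (δ̃ l) s) ℤ.+ -1ℤ ℤ.* (+ p ℤ.* ⟦ u ⟧ (⟦ E (suc e) ⟧ (δ̃ (suc l))) s)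
    pointwise s = begin
      ⟦ E (suc l ℕ.+ suc (suc m) ℕ.* r) ⟧ (δ̃ (suc l)) s
        ≡⟨ ≡.cong (λ e → ⟦ E e ⟧ (δ̃ (suc l)) s) (exponent l r′ m) ⟩
      ⟦ E (p ℕ.+ e) ⟧ (δ̃ (suc l)) s
        ≡⟨ ⟦E⟧-reduce e (δ̃ (suc l)) s ⟩
      ⟦ E e ⟧ (⟦ W ⟧ (δ̃ (suc l))) s ℤ.+ -1ℤ ℤ.* (+ p ℤ.* ⟦ u ⟧ (⟦ E (suc e) ⟧ (δ̃ (suc l))) s)
        ≡⟨ ≡.cong (ℤ._+ -1ℤ ℤ.* (+ p ℤ.* ⟦ u ⟧ (⟦ E (suc e) ⟧ (δ̃ (suc l))) s)) scalars ⟩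
      -1ℤ ℤ.* (+ p ℤ.* ⟦ E e ⟧ (δ̃ l) s) ℤ.+ -1ℤ ℤ.* (+ p ℤ.* ⟦ u ⟧ (⟦ E (suc e) ⟧ (δ̃ (suc l))) s) ∎
      where
      open ≡.≡-Reasoning
      scalars : ⟦ E e ⟧ (⟦ W ⟧ (δ̃ (suc l))) s ≡ -1ℤ ℤ.* (+ p ℤ.* ⟦ E e ⟧ (δ̃ l) s)
      scalars = ≡.trans (⟦⟧-ext (E e) (⟦W⟧δ̃-suc l) s)
        (≡.trans (⟦⟧-* (E e) -1ℤ (λ t → + p ℤ.* δ̃ l t) s) (≡.cong (-1ℤ ℤ.*_) (⟦⟧-* (E e) (+ p) (δ̃ l) s)))

  δ̃-suc : ∀ l → δ̃ (suc l) ≡ 0ℤ [mod p ]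
  δ̃-suc l = mkmod λ s → ≡.subst (+ p ∣ᶻ_) (≡.sym (ℤ.+-identityʳ (δ̃ (suc l) s)))
    (ℤ∣.∣m⇒∣m*n {m = + (p ℕ.^ suc l)} (δ q (suc l) s) (ℤ∣.∣ᵤ⇒∣ (ℕ.m∣m*n (p ℕ.^ l))))

  claim-zero-zero : Claim 0 0
  claim-zero-zero = ≡.subst₂ (λ e d → ⟦ E e ⟧ (δ̃ 0) ≡ 1ℤ [mod d ]) (≡.sym (ℕ.+-identityʳ r)) (≡.sym (ℕ.*-identityʳ p)) ⟦E⟧δ̃-base

  -- Both sides vanish modulo p: the scale p^(l+1) is divisible by p, and C(0, l+1) = 0.
  claim-zero-suc : ∀ l → Claim 0 (suc l)
  claim-zero-suc l = ≡.subst (λ d → ⟦ E (suc l ℕ.+ 1 ℕ.* r) ⟧ (δ̃ (suc l)) ≡ 0ℤ [mod d ]) (≡.sym (ℕ.*-identityʳ p))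
    (mod-⟦⟧₀ (E (suc l ℕ.+ 1 ℕ.* r)) (δ̃-suc l))

  ⟦E⟧δ̃ : ∀ m l → Claim m l
  ⟦E⟧δ̃ = pascal-induction Claim claim-zero-zero claim-zero-suc claim-suc-zero claim-suc-suc

  -- Interpolates between powers of `w` (i = 0) and powers of z^Q (j = 0), so that the factors can
  -- be exchanged one at a time.
  E′ : ℕ → ℕ → Op
  E′ i j = z ^ᵒ (Q ℕ.∸ 1) ⊗ ((z ^ᵒ Q) ^ᵒ i ⊗ w ^ᵒ j)

  -- z kills constants, so on δ̃ l the operator z E′ gains a factor p over E′, which absorbs the error p z h of w.
  E′-exchange : ∀ i j → E′ i (suc j) ≋ E′ (suc i) j ⊕ ι p ⊗ (h ⊗ (z ⊗ E′ i j))
  E′-exchange i j =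
    solve 7 (λ a v v^ w^ P z h → a :* (v^ :* ((v :+ P :* (z :* h)) :* w^)) := a :* ((v :* v^) :* w^) :+ P :* (h :* (z :* (a :* (v^ :* w^)))))
      ≋-refl (z ^ᵒ (Q ℕ.∸ 1)) (z ^ᵒ Q) ((z ^ᵒ Q) ^ᵒ i) (w ^ᵒ j) (ι p) z h

  E′-exchange-⟦⟧ : ∀ i j f s →
    ⟦ E′ (suc i) j ⟧ f s ≡ ⟦ E′ i (suc j) ⟧ f s ℤ.+ -1ℤ ℤ.* (+ p ℤ.* ⟦ h ⟧ (⟦ z ⊗ E′ i j ⟧ f) s)
  E′-exchange-⟦⟧ i j f s = ≡.trans (subtract (⟦ E′ (suc i) j ⟧ f s) (⟦ ι p ⊗ (h ⊗ (z ⊗ E′ i j)) ⟧ f s))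
    (≡.cong₂ (λ x y → x ℤ.+ -1ℤ ℤ.* y) (≡.sym (action (E′-exchange i j) f s)) (⟦ι⟧ p (⟦ h ⊗ (z ⊗ E′ i j) ⟧ f) s))
    where
    subtract : ∀ x y → x ≡ (x ℤ.+ y) ℤ.+ -1ℤ ℤ.* y
    subtract = ℤ-Tactic.solve-∀

  E′-zero : ∀ j → E′ 0 j ≋ E j
  E′-zero j = ≋-trans
    (solve 2 (λ a b → a :* (:con 1 :* b) := a :* b) ≋-refl (z ^ᵒ (Q ℕ.∸ 1)) (w ^ᵒ j))
    (≋-sym (E-def j))

  mod-error : ∀ {d f} → f ≡ 0ℤ [mod d ] → (λ s → -1ℤ ℤ.* (+ p ℤ.* ⟦ h ⟧ f s)) ≡ 0ℤ [mod p ℕ.* d ]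
  mod-error f≡0 = mod-cong (λ _ → ≡.refl) (≡.cong (-1ℤ ℤ.*_) (ℤ.*-zeroʳ (+ p))) (mod-* -1ℤ (mod-scale p (mod-⟦⟧₀ h f≡0)))

  -- Induction on m and i. An exchange keeps i + j in its main term; its error loses one factor but
  -- carries a p, so the bound for m suffices there.
  ⟦zE′⟧δ̃ : ∀ m l i j → l ℕ.+ m ℕ.* r ℕ.≤ i ℕ.+ j → ⟦ z ⊗ E′ i j ⟧ (δ̃ l) ≡ 0ℤ [mod p ℕ.^ m ]
  ⟦zE′⟧δ̃ zero    l i       j N≤ = mod1 _ _
  ⟦zE′⟧δ̃ (suc m) l zero    j N≤ = mod-cong
    (λ s → ≡.trans (⟦⟧-ext z (action (≋-trans (E′-zero j) (≋-trans (≡.subst (λ e → E j ≋ E e) (≡.sym (ℕ.m∸n+n≡m N≤)) ≋-refl) (E-split (j ℕ.∸ (l ℕ.+ suc m ℕ.* r)) (l ℕ.+ suc m ℕ.* r)))) (δ̃ l)) s)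
      (⟦⟧-comm z (w ^ᵒ (j ℕ.∸ (l ℕ.+ suc m ℕ.* r))) (⟦ E (l ℕ.+ suc m ℕ.* r) ⟧ (δ̃ l)) s)) ≡.refl
    -- With only `w` left, `⟦E⟧δ̃` gives a constant modulo p^(m+1), and `aug z` is 0; the surplus
    -- powers of `w` act afterwards.
    (mod-⟦⟧₀ (w ^ᵒ (j ℕ.∸ (l ℕ.+ suc m ℕ.* r))) (mod-⟦⟧ z (⟦E⟧δ̃ m l)))
  ⟦zE′⟧δ̃ (suc m) l (suc i) j N≤ = mod-cong
    (λ s → ≡.trans (⟦⟧-ext z (E′-exchange-⟦⟧ i j (δ̃ l)) s) (⟦⟧-+ z (⟦ E′ i (suc j) ⟧ (δ̃ l)) (λ t → -1ℤ ℤ.* (+ p ℤ.* ⟦ h ⟧ (⟦ z ⊗ E′ i j ⟧ (δ̃ l)) t)) s)) ≡.refl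
    (mod-+ (⟦zE′⟧δ̃ (suc m) l i (suc j) (≡.subst (l ℕ.+ suc m ℕ.* r ℕ.≤_) (≡.sym (ℕ.+-suc i j)) N≤))
      (mod-⟦⟧₀ z (mod-error (⟦zE′⟧δ̃ m l i j (ℕ.s≤s⁻¹ (ℕ.≤-trans room N≤))))))
    where
    -- Lowering m by one relaxes the bound by r = p - 1, which is at least the one factor lost.
    room : suc (l ℕ.+ m ℕ.* r) ℕ.≤ l ℕ.+ suc m ℕ.* r
    room = ≡.subst (suc (l ℕ.+ m ℕ.* r) ℕ.≤_) (exponent l m r′) (ℕ.m≤m+n _ r′)
      where
      exponent : ∀ l m r′ → suc (l ℕ.+ m ℕ.* suc r′) ℕ.+ r′ ≡ l ℕ.+ suc m ℕ.* suc r′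
      exponent = ℕ-Tactic.solve-∀

  -- The error of an exchange has i + j one below l + (m+1)(p-1), hence still at least l + m(p-1).
  -- So `⟦zE′⟧δ̃` makes it vanish modulo p^m, and its prefactor p completes p^(m+1).
  ⟦E′⟧δ̃ : ∀ m l i j → i ℕ.+ j ≡ l ℕ.+ suc m ℕ.* r → ⟦ E′ i j ⟧ (δ̃ l) ≡ leading m l [mod p ℕ.^ suc m ]
  ⟦E′⟧δ̃ m l zero    j ≡.refl = mod-cong (action (E′-zero j) (δ̃ l)) ≡.refl (⟦E⟧δ̃ m l)
  ⟦E′⟧δ̃ m l (suc i) j i+j≡N = mod-cong (E′-exchange-⟦⟧ i j (δ̃ l)) (ℤ.+-identityʳ (leading m l))
    (mod-+ (⟦E′⟧δ̃ m l i (suc j) (≡.trans (ℕ.+-suc i j) i+j≡N))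
      (mod-error (⟦zE′⟧δ̃ m l i j (ℕ.≤-trans (ℕ.+-monoʳ-≤ l (ℕ.m≤n+m (m ℕ.* r) r′)) (ℕ.≤-reflexive (ℕ.suc-injective (≡.trans (≡.sym (ℕ.+-suc l _)) (≡.sym i+j≡N))))))))

  ⟦z^n⟧δ̃ : ∀ m l → ⟦ z ^ᵒ ((l ℕ.+ 1) ℕ.* Q ℕ.∸ 1 ℕ.+ suc m ℕ.* (Q ℕ.* r)) ⟧ (δ̃ l) ≡ leading m l [mod p ℕ.^ suc m ]
  ⟦z^n⟧δ̃ m l = mod-cong (action identity (δ̃ l)) ≡.refl (⟦E′⟧δ̃ m l N 0 (ℕ.+-identityʳ N))
    where
    N n : ℕ
    N = l ℕ.+ suc m ℕ.* r
    n = (l ℕ.+ 1) ℕ.* Q ℕ.∸ 1 ℕ.+ suc m ℕ.* (Q ℕ.* r)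
    exponent : n ≡ (Q ℕ.∸ 1) ℕ.+ Q ℕ.* N
    exponent = begin
      (l ℕ.+ 1) ℕ.* Q ℕ.∸ 1 ℕ.+ suc m ℕ.* (Q ℕ.* r)
        ≡⟨ ≡.cong (λ x → x ℕ.* Q ℕ.∸ 1 ℕ.+ suc m ℕ.* (Q ℕ.* r)) (ℕ.+-comm l 1) ⟩
      Q ℕ.+ l ℕ.* Q ℕ.∸ 1 ℕ.+ suc m ℕ.* (Q ℕ.* r)
        ≡⟨ ≡.cong (ℕ._+ suc m ℕ.* (Q ℕ.* r)) (ℕ.+-∸-comm (l ℕ.* Q) (ℕ.>-nonZero⁻¹ Q)) ⟩
      (Q ℕ.∸ 1 ℕ.+ l ℕ.* Q) ℕ.+ suc m ℕ.* (Q ℕ.* r)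
        ≡⟨ collect (Q ℕ.∸ 1) Q l (suc m) r ⟩
      (Q ℕ.∸ 1) ℕ.+ Q ℕ.* N ∎
      where
      open ≡.≡-Reasoning
      collect : ∀ c Q l m r → (c ℕ.+ l ℕ.* Q) ℕ.+ m ℕ.* (Q ℕ.* r) ≡ c ℕ.+ Q ℕ.* (l ℕ.+ m ℕ.* r)
      collect = ℕ-Tactic.solve-∀
    identity : z ^ᵒ n ≋ E′ N 0
    identity = begin
      z ^ᵒ n                                          ≈⟨ ^-congʳ z exponent ⟩
      z ^ᵒ ((Q ℕ.∸ 1) ℕ.+ Q ℕ.* N)                    ≈⟨ ^-homo-* z (Q ℕ.∸ 1) (Q ℕ.* N) ⟩
      z ^ᵒ (Q ℕ.∸ 1) ⊗ z ^ᵒ (Q ℕ.* N)                  ≈⟨ *-congˡ (^-assocʳ z Q N) ⟨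
      z ^ᵒ (Q ℕ.∸ 1) ⊗ (z ^ᵒ Q) ^ᵒ N                    ≈⟨ solve 2 (λ a b → a :* b := a :* (b :* :con 1)) ≋-refl (z ^ᵒ (Q ℕ.∸ 1)) ((z ^ᵒ Q) ^ᵒ N) ⟩
      z ^ᵒ (Q ℕ.∸ 1) ⊗ ((z ^ᵒ Q) ^ᵒ N ⊗ con 1ℤ)         ∎
      where open import Relation.Binary.Reasoning.Setoid setoid

-- Euler's totient and floor division

∣pⁿ⇒coprime : ∀ {p k} → Prime p → ¬ p ℕ.∣ k → ∀ n → Coprime k (p ℕ.^ n)
∣pⁿ⇒coprime pp p∤k zero    (_ , d∣1) = ℕ.∣1⇒≡1 d∣1
∣pⁿ⇒coprime {p} pp p∤k (suc n) {d} (d∣k , d∣pⁿ⁺¹) = ∣pⁿ⇒coprime pp p∤k n (d∣k , coprime-divisor coprime d∣pⁿ⁺¹)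
  where
  coprime : Coprime d p
  coprime (e∣d , e∣p) with prime⇒irreducible pp e∣p
  ... | inj₁ e≡1    = e≡1
  ... | inj₂ ≡.refl = ⊥-elim (p∤k (ℕ.∣-trans e∣d d∣k))

module _ {p b : ℕ} (p-prime : Prime p) where

  private
    q r : ℕ
    q = p ℕ.^ suc b
    r = p ℕ.∸ 1
    instance
      p≢0 : ℕ.NonZero p
      p≢0 = prime⇒nonZero p-prime

  -- Separates the range from the modulus q, so that the range can grow by one number; `φ q` is by
  -- definition its value at q.
  coprimes : ℕ → ℕ
  coprimes n = length (filter (λ k → coprime? k q) (map suc (upTo n)))

  coprimes-snoc : ∀ n → coprimes (suc n) ≡ coprimes n ℕ.+ length (filter (λ k → coprime? k q) (suc n ∷ []))
  coprimes-snoc n = begin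
    coprimes (suc n)
      ≡⟨ ≡.cong (λ ks → length (filter P (map suc ks))) (List.upTo-∷ʳ n) ⟨
    length (filter P (map suc (upTo n ∷ʳ n)))
      ≡⟨ ≡.cong (length ∘ filter P) (List.map-++ suc (upTo n) (n ∷ [])) ⟩
    length (filter P (map suc (upTo n) ++ suc n ∷ []))
      ≡⟨ ≡.cong length (List.filter-++ P (map suc (upTo n)) (suc n ∷ [])) ⟩
    length (filter P (map suc (upTo n)) ++ filter P (suc n ∷ []))
      ≡⟨ List.length-++ (filter P (map suc (upTo n))) ⟩
    coprimes n ℕ.+ length (filter P (suc n ∷ [])) ∎
    where
    open ≡.≡-Reasoning
    P : ∀ k → _
    P k = coprime? k q

  coprimes-multiple : ∀ {n} → p ℕ.∣ suc n → coprimes (suc n) ≡ coprimes n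
  coprimes-multiple {n} p∣1+n = ≡.trans (coprimes-snoc n) (≡.trans
    (≡.cong (λ ks → coprimes n ℕ.+ length ks) (List.filter-reject (λ k → coprime? k q) not-coprime)) (ℕ.+-identityʳ _))
    where
    not-coprime : ¬ Coprime (suc n) q
    not-coprime c = ¬prime[1] (≡.subst Prime (c (p∣1+n , ℕ.m∣m*n (p ℕ.^ b))) p-prime)

  coprimes-nonmultiple : ∀ {n} → ¬ p ℕ.∣ suc n → coprimes (suc n) ≡ suc (coprimes n)
  coprimes-nonmultiple {n} p∤1+n = ≡.trans (coprimes-snoc n) (≡.trans
    (≡.cong (λ ks → coprimes n ℕ.+ length ks) (List.filter-accept (λ k → coprime? k q) (∣pⁿ⇒coprime p-prime p∤1+n (suc b))))
    (ℕ.+-comm (coprimes n) 1))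

  -- M counts complete blocks of p numbers and j the non-multiples of p in the block begun; the
  -- multiple that closes a block adds nothing.
  coprimes-count : ∀ M j → j ℕ.≤ r → coprimes (j ℕ.+ M ℕ.* p) ≡ j ℕ.+ M ℕ.* r
  coprimes-count zero    zero    _   = ≡.refl
  coprimes-count (suc M) zero    _   = begin
    coprimes (p ℕ.+ M ℕ.* p)             ≡⟨ ≡.cong (λ x → coprimes (x ℕ.+ M ℕ.* p)) (ℕ.suc-pred p) ⟨
    coprimes (suc (r ℕ.+ M ℕ.* p))       ≡⟨ coprimes-multiple (≡.subst (λ x → p ℕ.∣ x ℕ.+ M ℕ.* p) (≡.sym (ℕ.suc-pred p)) (ℕ.divides (suc M) ≡.refl)) ⟩
    coprimes (r ℕ.+ M ℕ.* p)             ≡⟨ coprimes-count M r ℕ.≤-refl ⟩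
    r ℕ.+ M ℕ.* r                        ∎
    where open ≡.≡-Reasoning
  coprimes-count M       (suc j) j<r = ≡.trans (coprimes-nonmultiple p∤) (≡.cong suc (coprimes-count M j (ℕ.<⇒≤ j<r)))
    where
    p∤ : ¬ p ℕ.∣ suc j ℕ.+ M ℕ.* p
    p∤ p∣ = ℕ.<⇒≱ (ℕ.≤-<-trans j<r (ℕ.≤-reflexive (ℕ.suc-pred p))) (ℕ.∣⇒≤ (ℕ.∣m+n∣m⇒∣n (≡.subst (p ℕ.∣_) (ℕ.+-comm (suc j) (M ℕ.* p)) p∣) (ℕ.n∣m*n M)))

  φ-prime-power : φ q ≡ p ℕ.^ b ℕ.* r
  φ-prime-power = ≡.trans (≡.cong coprimes (ℕ.*-comm p (p ℕ.^ b))) (coprimes-count (p ℕ.^ b) 0 z≤n)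

module _ (d : ℕ) .{{_ : ℕ.NonZero d}} where

  -- Both candidates satisfy the floor inequalities for the same number, so each bounds the other.
  -- Negative x is included, as the exponent is negative for large l.
  /ℕ-unique : ∀ x {r} → r ℕ.< d → (+ r ℤ.+ x ℤ.* + d) ℤ./ℕ d ≡ x
  /ℕ-unique x {r} r<d = ℤ.≤-antisym (below y/d x lower) (below x y/d upper)
    where
    y y/d : ℤ
    y   = + r ℤ.+ x ℤ.* + d
    y/d = y ℤ./ℕ d
    lower : y/d ℤ.* + d ℤ.< ℤ.suc x ℤ.* + d
    lower = ℤ.≤-<-trans (ℤ.[n/ℕd]*d≤n y d)
      (≡.subst (y ℤ.<_) (≡.sym (ℤ.suc-* x (+ d))) (ℤ.+-monoˡ-< (x ℤ.* + d) (ℤ.+<+ r<d)))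
    upper : x ℤ.* + d ℤ.< ℤ.suc y/d ℤ.* + d
    upper = ℤ.≤-<-trans (ℤ.i≤j+i (x ℤ.* + d) (+ r)) (ℤ.n<s[n/ℕd]*d y d)
    below : ∀ i j → i ℤ.* + d ℤ.< ℤ.suc j ℤ.* + d → i ℤ.≤ j
    below i j lt = ≡.subst (i ℤ.≤_) (ℤ.pred-suc j) (ℤ.i<j⇒i≤pred[j] (ℤ.*-cancelʳ-<-nonNeg {i} {ℤ.suc j} (+ d) lt))

  j*d%ℕd≡0 : ∀ j → (j ℤ.* + d) ℤ.%ℕ d ≡ 0
  j*d%ℕd≡0 j = ℤ.+-injective (∙-cancelʳ (y/d ℤ.* + d) (+ (y ℤ.%ℕ d)) 0ℤ (begin
    + (y ℤ.%ℕ d) ℤ.+ y/d ℤ.* + d ≡⟨ ℤ.a≡a%ℕn+[a/ℕn]*n y d ⟨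
    j ℤ.* + d                    ≡⟨ ≡.cong (ℤ._* + d) y/d≡j ⟨
    y/d ℤ.* + d                  ≡⟨ ℤ.+-identityˡ _ ⟨
    0ℤ ℤ.+ y/d ℤ.* + d           ∎))
    where
    open ≡.≡-Reasoning
    y y/d : ℤ
    y   = j ℤ.* + d
    y/d = y ℤ./ℕ d
    y/d≡j : y/d ≡ j
    y/d≡j = ≡.trans (≡.cong (λ t → t ℤ./ℕ d) (≡.sym (ℤ.+-identityˡ y))) (/ℕ-unique j (ℕ.>-nonZero⁻¹ d))

floorDiv≡/ℕ : ∀ x d .{{_ : ℕ.NonZero d}} → floorDiv x d ≡ x ℤ./ℕ d
floorDiv≡/ℕ x (suc d) = ≡.refl

-- Rational binomial coefficients and the sum of the statement

toℚᵘ-ℤ→ℚ : ∀ x → toℚᵘ (ℤ→ℚ x) ℚᵘ.≃ mkℚᵘ x 0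
toℚᵘ-ℤ→ℚ x = ℚ.toℚᵘ-fromℚᵘ (mkℚᵘ x 0)

ℤ→ℚ-+ : ∀ x y → ℤ→ℚ (x ℤ.+ y) ≡ ℤ→ℚ x ℚ.+ ℤ→ℚ y
ℤ→ℚ-+ x y = ℚ.toℚᵘ-injective (begin
  toℚᵘ (ℤ→ℚ (x ℤ.+ y))                  ≈⟨ toℚᵘ-ℤ→ℚ (x ℤ.+ y) ⟩
  mkℚᵘ (x ℤ.+ y) 0                      ≈⟨ *≡* (identity x y) ⟩
  mkℚᵘ x 0 ℚᵘ.+ mkℚᵘ y 0                ≈⟨ ℚᵘ.+-cong (toℚᵘ-ℤ→ℚ x) (toℚᵘ-ℤ→ℚ y) ⟨
  toℚᵘ (ℤ→ℚ x) ℚᵘ.+ toℚᵘ (ℤ→ℚ y)        ≈⟨ ℚ.toℚᵘ-homo-+ (ℤ→ℚ x) (ℤ→ℚ y) ⟨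
  toℚᵘ (ℤ→ℚ x ℚ.+ ℤ→ℚ y)                ∎)
  where
  open import Relation.Binary.Reasoning.Setoid ℚᵘ.≃-setoid
  identity : ∀ x y → (x ℤ.+ y) ℤ.* 1ℤ ≡ (x ℤ.* 1ℤ ℤ.+ y ℤ.* 1ℤ) ℤ.* 1ℤ
  identity = ℤ-Tactic.solve-∀

ℤ→ℚ-* : ∀ x y → ℤ→ℚ (x ℤ.* y) ≡ ℤ→ℚ x ℚ.* ℤ→ℚ y
ℤ→ℚ-* x y = ℚ.toℚᵘ-injective (begin
  toℚᵘ (ℤ→ℚ (x ℤ.* y))                  ≈⟨ toℚᵘ-ℤ→ℚ (x ℤ.* y) ⟩
  mkℚᵘ x 0 ℚᵘ.* mkℚᵘ y 0                ≈⟨ ℚᵘ.*-cong (toℚᵘ-ℤ→ℚ x) (toℚᵘ-ℤ→ℚ y) ⟨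
  toℚᵘ (ℤ→ℚ x) ℚᵘ.* toℚᵘ (ℤ→ℚ y)        ≈⟨ ℚ.toℚᵘ-homo-* (ℤ→ℚ x) (ℤ→ℚ y) ⟨
  toℚᵘ (ℤ→ℚ x ℚ.* ℤ→ℚ y)                ∎)
  where open import Relation.Binary.Reasoning.Setoid ℚᵘ.≃-setoid

ℤ→ℚ-neg : ∀ x → ℤ→ℚ (ℤ.- x) ≡ ℚ.- ℤ→ℚ x
ℤ→ℚ-neg x = ℚ.toℚᵘ-injective (begin
  toℚᵘ (ℤ→ℚ (ℤ.- x))                    ≈⟨ toℚᵘ-ℤ→ℚ (ℤ.- x) ⟩
  ℚᵘ.- mkℚᵘ x 0                         ≈⟨ ℚᵘ.-‿cong (toℚᵘ-ℤ→ℚ x) ⟨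
  ℚᵘ.- toℚᵘ (ℤ→ℚ x)                     ≈⟨ ℚ.toℚᵘ-homo‿- (ℤ→ℚ x) ⟨
  toℚᵘ (ℚ.- ℤ→ℚ x)                      ∎)
  where open import Relation.Binary.Reasoning.Setoid ℚᵘ.≃-setoid

ℤ→ℚ-cancel : ∀ j d .{{_ : ℕ.NonZero d}} → ℤ→ℚ (j ℤ.* + d) ℚ.* ((+ 1) ℚ./ d) ≡ ℤ→ℚ j
ℤ→ℚ-cancel j d@(suc d-1) = ℚ.toℚᵘ-injective (begin
  toℚᵘ (ℤ→ℚ (j ℤ.* + d) ℚ.* ((+ 1) ℚ./ d))          ≈⟨ ℚ.toℚᵘ-homo-* (ℤ→ℚ (j ℤ.* + d)) ((+ 1) ℚ./ d) ⟩
  toℚᵘ (ℤ→ℚ (j ℤ.* + d)) ℚᵘ.* toℚᵘ ((+ 1) ℚ./ d)    ≈⟨ ℚᵘ.*-cong (toℚᵘ-ℤ→ℚ (j ℤ.* + d)) (ℚ.toℚᵘ-fromℚᵘ (mkℚᵘ (+ 1) d-1)) ⟩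
  mkℚᵘ (j ℤ.* + d) 0 ℚᵘ.* mkℚᵘ (+ 1) d-1            ≈⟨ *≡* (≡.trans (identity j (+ d)) (≡.cong (λ x → j ℤ.* + x) (≡.sym (ℕ.+-identityʳ d)))) ⟩
  mkℚᵘ j 0                                          ≈⟨ toℚᵘ-ℤ→ℚ j ⟨
  toℚᵘ (ℤ→ℚ j)                                      ∎)
  where
  open import Relation.Binary.Reasoning.Setoid ℚᵘ.≃-setoid
  identity : ∀ j d → (j ℤ.* d ℤ.* 1ℤ) ℤ.* 1ℤ ≡ j ℤ.* d
  identity = ℤ-Tactic.solve-∀

module _ where
  open ℚ-Solver.+-*-Solver using (solve; _:+_; _:*_; _:-_; _:=_) renaming (con to :con)

  private
    inv : ℕ → ℚ
    inv l = (+ 1) ℚ./ suc l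

    sucℚ : ∀ l → ℤ→ℚ (+ suc l) ≡ 1ℚ ℚ.+ ℤ→ℚ (+ l)
    sucℚ l = ℤ→ℚ-+ 1ℤ (+ l)

    suc*inv : ∀ l → (1ℚ ℚ.+ ℤ→ℚ (+ l)) ℚ.* inv l ≡ 1ℚ
    suc*inv l = ≡.trans (≡.cong (ℚ._* inv l) (≡.trans (≡.sym (sucℚ l)) (≡.cong ℤ→ℚ (≡.sym (ℤ.*-identityˡ (+ suc l)))))) (ℤ→ℚ-cancel 1ℤ (suc l))

  binomℚ-absorb : ∀ x l → binomℚ (1ℚ ℚ.+ x) (suc l) ≡ (1ℚ ℚ.+ x) ℚ.* (binomℚ x l ℚ.* inv l)
  binomℚ-absorb x zero = solve 2 (λ x i → :con 1ℚ :* ((:con 1ℚ :+ x :- :con 0ℚ) :* i) := (:con 1ℚ :+ x) :* (:con 1ℚ :* i)) ≡.refl x (inv 0)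
  binomℚ-absorb x (suc l) = begin
    binomℚ (1ℚ ℚ.+ x) (suc l) ℚ.* ((1ℚ ℚ.+ x ℚ.- ℤ→ℚ (+ suc l)) ℚ.* inv (suc l))
      ≡⟨ ≡.cong₂ (λ b y → b ℚ.* ((1ℚ ℚ.+ x ℚ.- y) ℚ.* inv (suc l))) (binomℚ-absorb x l) (sucℚ l) ⟩
    ((1ℚ ℚ.+ x) ℚ.* (binomℚ x l ℚ.* inv l)) ℚ.* ((1ℚ ℚ.+ x ℚ.- (1ℚ ℚ.+ ℤ→ℚ (+ l))) ℚ.* inv (suc l))
      ≡⟨ solve 5 (λ x b i y j → ((:con 1ℚ :+ x) :* (b :* i)) :* ((:con 1ℚ :+ x :- (:con 1ℚ :+ y)) :* j)
                   := (:con 1ℚ :+ x) :* ((b :* ((x :- y) :* i)) :* j)) ≡.refl x (binomℚ x l) (inv l) (ℤ→ℚ (+ l)) (inv (suc l)) ⟩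
    (1ℚ ℚ.+ x) ℚ.* (binomℚ x (suc l) ℚ.* inv (suc l)) ∎
    where open ≡.≡-Reasoning

  -- After absorption, 1 + x is split as (x - l) + (1 + l): the first part extends the product, the
  -- second cancels 1/(l+1).
  binomℚ-pascal : ∀ x l → binomℚ (1ℚ ℚ.+ x) (suc l) ≡ binomℚ x (suc l) ℚ.+ binomℚ x l
  binomℚ-pascal x l = begin
    binomℚ (1ℚ ℚ.+ x) (suc l)
      ≡⟨ binomℚ-absorb x l ⟩
    (1ℚ ℚ.+ x) ℚ.* (binomℚ x l ℚ.* inv l)
      ≡⟨ solve 4 (λ x b i y → (:con 1ℚ :+ x) :* (b :* i) := b :* ((x :- y) :* i) :+ b :* ((:con 1ℚ :+ y) :* i)) ≡.refl x (binomℚ x l) (inv l) (ℤ→ℚ (+ l)) ⟩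
    binomℚ x (suc l) ℚ.+ binomℚ x l ℚ.* ((1ℚ ℚ.+ ℤ→ℚ (+ l)) ℚ.* inv l)
      ≡⟨ ≡.cong (λ y → binomℚ x (suc l) ℚ.+ binomℚ x l ℚ.* y) (suc*inv l) ⟩
    binomℚ x (suc l) ℚ.+ binomℚ x l ℚ.* 1ℚ
      ≡⟨ ≡.cong (binomℚ x (suc l) ℚ.+_) (ℚ.*-identityʳ (binomℚ x l)) ⟩
    binomℚ x (suc l) ℚ.+ binomℚ x l ∎
    where open ≡.≡-Reasoning

  binomℚ-pascal⁻ : ∀ x l → binomℚ x (suc l) ≡ binomℚ (1ℚ ℚ.+ x) (suc l) ℚ.- binomℚ x l
  binomℚ-pascal⁻ x l = ≡.trans
    (solve 2 (λ a b → a := a :+ b :- b) ≡.refl (binomℚ x (suc l)) (binomℚ x l))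
    (≡.cong (ℚ._- binomℚ x l) (≡.sym (binomℚ-pascal x l)))

  binomℚ-zero : ∀ l → binomℚ 0ℚ (suc l) ≡ 0ℚ
  binomℚ-zero zero    = ≡.refl
  binomℚ-zero (suc l) = ≡.trans (≡.cong (ℚ._* ((0ℚ ℚ.- ℤ→ℚ (+ suc l)) ℚ.* inv (suc l))) (binomℚ-zero l))
    (ℚ.*-zeroˡ ((0ℚ ℚ.- ℤ→ℚ (+ suc l)) ℚ.* inv (suc l)))

ℤ→ℚ-- : ∀ x y → ℤ→ℚ (x ℤ.- y) ≡ ℤ→ℚ x ℚ.- ℤ→ℚ y
ℤ→ℚ-- x y = ≡.trans (ℤ→ℚ-+ x (ℤ.- y)) (≡.cong (ℤ→ℚ x ℚ.+_) (ℤ→ℚ-neg y))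

binomℚ-ℤ→ℚ : ∀ j l → binomℚ (ℤ→ℚ j) l ≡ ℤ→ℚ (binomialℤ j l)
binomℚ-ℤ→ℚ j              zero    = ≡.refl
binomℚ-ℤ→ℚ (+ zero)       (suc l) = binomℚ-zero l
binomℚ-ℤ→ℚ (+ suc n)      (suc l) = begin
  binomℚ (ℤ→ℚ (+ suc n)) (suc l)                          ≡⟨ ≡.cong (λ x → binomℚ x (suc l)) (ℤ→ℚ-+ 1ℤ (+ n)) ⟩
  binomℚ (1ℚ ℚ.+ ℤ→ℚ (+ n)) (suc l)                       ≡⟨ binomℚ-pascal (ℤ→ℚ (+ n)) l ⟩
  binomℚ (ℤ→ℚ (+ n)) (suc l) ℚ.+ binomℚ (ℤ→ℚ (+ n)) l     ≡⟨ ≡.cong₂ ℚ._+_ (binomℚ-ℤ→ℚ (+ n) (suc l)) (binomℚ-ℤ→ℚ (+ n) l) ⟩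
  ℤ→ℚ (binomialℤ (+ n) (suc l)) ℚ.+ ℤ→ℚ (binomialℤ (+ n) l) ≡⟨ ℤ→ℚ-+ (binomialℤ (+ n) (suc l)) (binomialℤ (+ n) l) ⟨
  ℤ→ℚ (binomialℤ (+ suc n) (suc l))                       ∎
  where open ≡.≡-Reasoning
binomℚ-ℤ→ℚ -[1+ zero  ]   (suc l) = begin
  binomℚ (ℤ→ℚ -1ℤ) (suc l)                                ≡⟨ binomℚ-pascal⁻ (ℤ→ℚ -1ℤ) l ⟩
  binomℚ 0ℚ (suc l) ℚ.- binomℚ (ℤ→ℚ -1ℤ) l                ≡⟨ ≡.cong₂ ℚ._-_ (binomℚ-zero l) (binomℚ-ℤ→ℚ -1ℤ l) ⟩
  0ℚ ℚ.- ℤ→ℚ (binomialℤ -1ℤ l)                            ≡⟨ ℤ→ℚ-- 0ℤ (binomialℤ -1ℤ l) ⟨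
  ℤ→ℚ (binomialℤ -1ℤ (suc l))                             ∎
  where open ≡.≡-Reasoning
binomℚ-ℤ→ℚ -[1+ suc n ]   (suc l) = begin
  binomℚ (ℤ→ℚ -[1+ suc n ]) (suc l)                       ≡⟨ binomℚ-pascal⁻ (ℤ→ℚ -[1+ suc n ]) l ⟩
  binomℚ (1ℚ ℚ.+ ℤ→ℚ -[1+ suc n ]) (suc l) ℚ.- binomℚ (ℤ→ℚ -[1+ suc n ]) l
    ≡⟨ ≡.cong (λ x → binomℚ x (suc l) ℚ.- binomℚ (ℤ→ℚ -[1+ suc n ]) l) (ℤ→ℚ-+ 1ℤ -[1+ suc n ]) ⟨
  binomℚ (ℤ→ℚ -[1+ n ]) (suc l) ℚ.- binomℚ (ℤ→ℚ -[1+ suc n ]) l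
    ≡⟨ ≡.cong₂ ℚ._-_ (binomℚ-ℤ→ℚ -[1+ n ] (suc l)) (binomℚ-ℤ→ℚ -[1+ suc n ] l) ⟩
  ℤ→ℚ (binomialℤ -[1+ n ] (suc l)) ℚ.- ℤ→ℚ (binomialℤ -[1+ suc n ] l)
    ≡⟨ ℤ→ℚ-- (binomialℤ -[1+ n ] (suc l)) (binomialℤ -[1+ suc n ] l) ⟨
  ℤ→ℚ (binomialℤ -[1+ suc n ] (suc l))                    ∎
  where open ≡.≡-Reasoning

-- The sum of the statement as a value of z^n

∑ℤ : (ℕ → ℤ) → ℕ → ℤ
∑ℤ f n = foldr ℤ._+_ 0ℤ (applyUpTo f n)

∑ℤ-cong : ∀ {f g} n → (∀ k → f k ≡ g k) → ∑ℤ f n ≡ ∑ℤ g n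
∑ℤ-cong zero    f≡g = ≡.refl
∑ℤ-cong (suc n) f≡g = ≡.cong₂ ℤ._+_ (f≡g 0) (∑ℤ-cong n (f≡g ∘ suc))

∑ℤ-* : ∀ a f n → ∑ℤ (λ k → a ℤ.* f k) n ≡ a ℤ.* ∑ℤ f n
∑ℤ-* a f zero    = ≡.sym (ℤ.*-zeroʳ a)
∑ℤ-* a f (suc n) = ≡.trans (≡.cong (λ x → a ℤ.* f 0 ℤ.+ x) (∑ℤ-* a (f ∘ suc) n)) (≡.sym (ℤ.*-distribˡ-+ a (f 0) (∑ℤ (f ∘ suc) n)))

ℤ→ℚ-∑ : ∀ f g n → (∀ k → f k ≡ ℤ→ℚ (g k)) → foldr ℚ._+_ 0ℚ (applyUpTo f n) ≡ ℤ→ℚ (∑ℤ g n)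
ℤ→ℚ-∑ f g zero    f≡g = ≡.refl
ℤ→ℚ-∑ f g (suc n) f≡g = ≡.trans (≡.cong₂ ℚ._+_ (f≡g 0) (ℤ→ℚ-∑ (f ∘ suc) (g ∘ suc) n (f≡g ∘ suc))) (≡.sym (ℤ→ℚ-+ (g 0) (∑ℤ (g ∘ suc) n)))

⟦∑ᶜ⟧ : ∀ c n f s → ⟦ ∑ᶜ c n (con 1ℤ) (con -1ℤ ⊗ X) ⟧ f s ≡ ∑ℤ (λ k → -1ℤ ℤ.^ k ℤ.* (+ c k ℤ.* f (s ℤ.+ + k))) (suc n)
⟦∑ᶜ⟧ c zero    f s = ≡.trans (⟦ι⟧ (c 0) f s) (≡.trans
  (≡.cong (λ t → + c 0 ℤ.* f t) (≡.sym (ℤ.+-identityʳ s)))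
  (identity (+ c 0 ℤ.* f (s ℤ.+ 0ℤ))))
  where
  identity : ∀ x → x ≡ 1ℤ ℤ.* x ℤ.+ 0ℤ
  identity = ℤ-Tactic.solve-∀
⟦∑ᶜ⟧ c (suc n) f s = ≡.cong₂ ℤ._+_ head tail
  where
  term : ℕ → ℤ
  term k = -1ℤ ℤ.^ k ℤ.* (+ c k ℤ.* f (s ℤ.+ + k))
  head : ⟦ ι (c 0) ⊗ con 1ℤ ^ᵒ suc n ⟧ f s ≡ term 0
  head = begin
    ⟦ ι (c 0) ⊗ con 1ℤ ^ᵒ suc n ⟧ f s   ≡⟨ ⟦⟧-ext (ι (c 0)) (λ t → ≡.trans (action (1^n≈1 (suc n)) f t) (ℤ.*-identityˡ (f t))) s ⟩
    ⟦ ι (c 0) ⟧ f s                    ≡⟨ ⟦ι⟧ (c 0) f s ⟩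
    + c 0 ℤ.* f s                      ≡⟨ ≡.cong (λ t → + c 0 ℤ.* f t) (ℤ.+-identityʳ s) ⟨
    + c 0 ℤ.* f (s ℤ.+ 0ℤ)             ≡⟨ ℤ.*-identityˡ _ ⟨
    term 0                             ∎
    where open ≡.≡-Reasoning
  shifted : ∀ k → -1ℤ ℤ.* (-1ℤ ℤ.^ k ℤ.* (+ c (suc k) ℤ.* f (s ℤ.+ 1ℤ ℤ.+ + k))) ≡ term (suc k)
  shifted k = ≡.trans (≡.sym (ℤ.*-assoc -1ℤ (-1ℤ ℤ.^ k) _))
    (≡.cong (λ t → -1ℤ ℤ.^ suc k ℤ.* (+ c (suc k) ℤ.* f t)) (ℤ.+-assoc s 1ℤ (+ k)))
  tail : -1ℤ ℤ.* ⟦ ∑ᶜ (c ∘ suc) n (con 1ℤ) (con -1ℤ ⊗ X) ⟧ f (s ℤ.+ 1ℤ) ≡ ∑ℤ (term ∘ suc) (suc n)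
  tail = ≡.trans (≡.cong (-1ℤ ℤ.*_) (⟦∑ᶜ⟧ (c ∘ suc) n f (s ℤ.+ 1ℤ)))
    (≡.trans (≡.sym (∑ℤ-* -1ℤ (λ k → -1ℤ ℤ.^ k ℤ.* (+ c (suc k) ℤ.* f (s ℤ.+ 1ℤ ℤ.+ + k))) (suc n))) (∑ℤ-cong (suc n) shifted))

⟦z^n⟧ : ∀ n f s → ⟦ z ^ᵒ n ⟧ f s ≡ ∑ℤ (λ k → -1ℤ ℤ.^ k ℤ.* (+ (n C k) ℤ.* f (s ℤ.+ + k))) (suc n)
⟦z^n⟧ n f s = ≡.trans (action (binomial n (con 1ℤ) (con -1ℤ ⊗ X)) f s) (⟦∑ᶜ⟧ (n C_) n f s)

sgnℚ≡-1^ : ∀ k → sgnℚ k ≡ ℤ→ℚ (-1ℤ ℤ.^ k)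
sgnℚ≡-1^ zero    = ≡.refl
sgnℚ≡-1^ (suc k) = ≡.trans (≡.cong ℚ.-_ (sgnℚ≡-1^ k)) (≡.trans (≡.sym (ℤ→ℚ-neg (-1ℤ ℤ.^ k))) (≡.cong ℤ→ℚ (≡.sym (ℤ.-1*i≡-i (-1ℤ ℤ.^ k)))))

term : ∀ (n : ℕ) (r : ℤ) (l q : ℕ) .{{_ : ℕ.NonZero q}} → ℕ → ℚ
term n r l q k = if congB (+ k) r q
  then sgnℚ k ℚ.* (ℤ→ℚ (+ (n C k)) ℚ.* binomℚ (ℤ→ℚ (+ k ℤ.- r) ℚ.* ((+ 1) ℚ./ q)) l)
  else 0ℚ

innerSum≡∑term : ∀ n r l p b .{{_ : ℕ.NonZero (p ℕ.^ b)}} →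
  innerSum n r l p b ≡ foldr ℚ._+_ 0ℚ (map (term n r l (p ℕ.^ b)) (upTo (suc n)))
innerSum≡∑term n r l p b with p ℕ.^ b
-- Exposing p^b as a successor selects the branch of the reciprocal that is not the default 0.
... | suc q = ≡.refl

congB-true : ∀ {x r} q .{{_ : ℕ.NonZero q}} → congB x r q ≡ true → ∃ λ j → x ℤ.- r ≡ j ℤ.* + q
congB-true {x} {r} q@(suc _) eq with (x ℤ.- r) ℤ.%ℕ q in %≡
... | zero = (x ℤ.- r) ℤ./ℕ q , ≡.trans (ℤ.a≡a%ℕn+[a/ℕn]*n (x ℤ.- r) q)
  (≡.trans (≡.cong (λ m → + m ℤ.+ (x ℤ.- r) ℤ./ℕ q ℤ.* + q) %≡) (ℤ.+-identityˡ _))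

congB-false : ∀ {x r} q .{{_ : ℕ.NonZero q}} → congB x r q ≡ false → ¬ + q ∣ᶻ x ℤ.- r
congB-false {x} {r} q@(suc _) eq (ℤ∣.divides j x-r≡jq)
  with (x ℤ.- r) ℤ.%ℕ q | ≡.trans (≡.cong (ℤ._%ℕ q) x-r≡jq) (j*d%ℕd≡0 q j)
congB-false (suc _) () _ | .0 | ≡.refl

term≡ : ∀ n r l q .{{_ : ℕ.NonZero q}} k →
  term n r l q k ≡ ℤ→ℚ (-1ℤ ℤ.^ k ℤ.* (+ (n C k) ℤ.* δ q l (ℤ.- r ℤ.+ + k)))
term≡ n r l q k rewrite ℤ.+-comm (ℤ.- r) (+ k) with congB (+ k) r q in eq
... | false = ≡.cong ℤ→ℚ (begin
  0ℤ                                                       ≡⟨ ℤ.*-zeroʳ (-1ℤ ℤ.^ k) ⟨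
  -1ℤ ℤ.^ k ℤ.* 0ℤ                                         ≡⟨ ≡.cong (-1ℤ ℤ.^ k ℤ.*_) (ℤ.*-zeroʳ (+ (n C k))) ⟨
  -1ℤ ℤ.^ k ℤ.* (+ (n C k) ℤ.* 0ℤ)                         ≡⟨ ≡.cong (λ x → -1ℤ ℤ.^ k ℤ.* (+ (n C k) ℤ.* x)) (δ-nonmultiple q l (congB-false q eq)) ⟨
  -1ℤ ℤ.^ k ℤ.* (+ (n C k) ℤ.* δ q l (+ k ℤ.- r))          ∎)
  where open ≡.≡-Reasoning
... | true with j , k-r≡jq ← congB-true {+ k} {r} q eq = begin
  sgnℚ k ℚ.* (ℤ→ℚ (+ (n C k)) ℚ.* binomℚ (ℤ→ℚ (+ k ℤ.- r) ℚ.* ((+ 1) ℚ./ q)) l)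
    ≡⟨ ≡.cong₂ (λ ε x → ε ℚ.* (ℤ→ℚ (+ (n C k)) ℚ.* binomℚ x l)) (sgnℚ≡-1^ k)
         (≡.trans (≡.cong (λ x → ℤ→ℚ x ℚ.* ((+ 1) ℚ./ q)) k-r≡jq) (ℤ→ℚ-cancel j q)) ⟩
  ℤ→ℚ (-1ℤ ℤ.^ k) ℚ.* (ℤ→ℚ (+ (n C k)) ℚ.* binomℚ (ℤ→ℚ j) l)
    ≡⟨ ≡.cong (λ x → ℤ→ℚ (-1ℤ ℤ.^ k) ℚ.* (ℤ→ℚ (+ (n C k)) ℚ.* x)) (≡.trans (binomℚ-ℤ→ℚ j l) (≡.cong ℤ→ℚ (≡.sym δ≡))) ⟩
  ℤ→ℚ (-1ℤ ℤ.^ k) ℚ.* (ℤ→ℚ (+ (n C k)) ℚ.* ℤ→ℚ (δ q l (+ k ℤ.- r)))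
    ≡⟨ ≡.cong (ℤ→ℚ (-1ℤ ℤ.^ k) ℚ.*_) (ℤ→ℚ-* (+ (n C k)) (δ q l (+ k ℤ.- r))) ⟨
  ℤ→ℚ (-1ℤ ℤ.^ k) ℚ.* ℤ→ℚ (+ (n C k) ℤ.* δ q l (+ k ℤ.- r))
    ≡⟨ ℤ→ℚ-* (-1ℤ ℤ.^ k) (+ (n C k) ℤ.* δ q l (+ k ℤ.- r)) ⟨
  ℤ→ℚ (-1ℤ ℤ.^ k ℤ.* (+ (n C k) ℤ.* δ q l (+ k ℤ.- r))) ∎
  where
  open ≡.≡-Reasoning
  δ≡ : δ q l (+ k ℤ.- r) ≡ binomialℤ j l
  δ≡ = ≡.trans (≡.cong (δ q l) k-r≡jq) (δ-multiple q l j)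

innerSum≡⟦z^n⟧δ : ∀ n r l p b .{{_ : ℕ.NonZero (p ℕ.^ b)}} →
  innerSum n r l p b ≡ ℤ→ℚ (⟦ z ^ᵒ n ⟧ (δ (p ℕ.^ b) l) (ℤ.- r))
innerSum≡⟦z^n⟧δ n r l p b = begin
  innerSum n r l p b
    ≡⟨ innerSum≡∑term n r l p b ⟩
  foldr ℚ._+_ 0ℚ (map (term n r l (p ℕ.^ b)) (upTo (suc n)))
    ≡⟨ ≡.cong (foldr ℚ._+_ 0ℚ) (List.map-upTo (term n r l (p ℕ.^ b)) (suc n)) ⟩
  foldr ℚ._+_ 0ℚ (applyUpTo (term n r l (p ℕ.^ b)) (suc n))
    ≡⟨ ℤ→ℚ-∑ (term n r l (p ℕ.^ b)) (λ k → -1ℤ ℤ.^ k ℤ.* (+ (n C k) ℤ.* δ (p ℕ.^ b) l (ℤ.- r ℤ.+ + k))) (suc n) (term≡ n r l (p ℕ.^ b)) ⟩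
  ℤ→ℚ (∑ℤ (λ k → -1ℤ ℤ.^ k ℤ.* (+ (n C k) ℤ.* δ (p ℕ.^ b) l (ℤ.- r ℤ.+ + k))) (suc n))
    ≡⟨ ≡.cong ℤ→ℚ (⟦z^n⟧ n (δ (p ℕ.^ b) l) (ℤ.- r)) ⟨
  ℤ→ℚ (⟦ z ^ᵒ n ⟧ (δ (p ℕ.^ b) l) (ℤ.- r)) ∎
  where open ≡.≡-Reasoning

-- The normalising power of p

powℤℚ-negsuc : ∀ p e .{{_ : ℕ.NonZero (p ℕ.^ suc e)}} → powℤℚ p -[1+ e ] ≡ (+ 1) ℚ./ (p ℕ.^ suc e)
powℤℚ-negsuc p e with p ℕ.^ suc e
... | suc q = ≡.refl

powℤℚ-- : ∀ p .{{_ : ℕ.NonZero p}} l m → powℤℚ p (ℤ.- (+ m ℤ.- + l)) ℚ.* ℤ→ℚ (+ (p ℕ.^ m)) ≡ ℤ→ℚ (+ (p ℕ.^ l))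
powℤℚ-- p l m with m ℕ.≤? l
... | yes m≤l with d , ≡.refl ← ℕ.m≤n⇒∃[o]m+o≡n m≤l = begin
  powℤℚ p (ℤ.- (+ m ℤ.- (+ m ℤ.+ + d))) ℚ.* ℤ→ℚ (+ (p ℕ.^ m))
    ≡⟨ ≡.cong (λ e → powℤℚ p e ℚ.* ℤ→ℚ (+ (p ℕ.^ m))) (exponent (+ m) (+ d)) ⟩
  ℤ→ℚ (+ (p ℕ.^ d)) ℚ.* ℤ→ℚ (+ (p ℕ.^ m))
    ≡⟨ ℤ→ℚ-* (+ (p ℕ.^ d)) (+ (p ℕ.^ m)) ⟨
  ℤ→ℚ (+ (p ℕ.^ d) ℤ.* + (p ℕ.^ m))
    ≡⟨ ≡.cong ℤ→ℚ (ℤ.pos-* (p ℕ.^ d) (p ℕ.^ m)) ⟨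
  ℤ→ℚ (+ (p ℕ.^ d ℕ.* p ℕ.^ m))
    ≡⟨ ≡.cong (ℤ→ℚ ∘ +_) (≡.trans (≡.sym (ℕ.^-distribˡ-+-* p d m)) (≡.cong (p ℕ.^_) (ℕ.+-comm d m))) ⟩
  ℤ→ℚ (+ (p ℕ.^ (m ℕ.+ d))) ∎
  where
  open ≡.≡-Reasoning
  exponent : ∀ m d → ℤ.- (m ℤ.- (m ℤ.+ d)) ≡ d
  exponent = ℤ-Tactic.solve-∀
powℤℚ-- p l m | no m≰l with d , ≡.refl ← ℕ.m≤n⇒∃[o]m+o≡n (ℕ.≰⇒> m≰l) = begin
  powℤℚ p (ℤ.- (+ (suc l ℕ.+ d) ℤ.- + l)) ℚ.* ℤ→ℚ (+ (p ℕ.^ (suc l ℕ.+ d)))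
    ≡⟨ ≡.cong₂ (λ e x → powℤℚ p e ℚ.* ℤ→ℚ (+ x)) (exponent (+ l) (+ d)) (≡.trans (≡.cong (p ℕ.^_) (≡.sym (ℕ.+-suc l d))) (ℕ.^-distribˡ-+-* p l (suc d))) ⟩
  powℤℚ p -[1+ d ] ℚ.* ℤ→ℚ (+ (p ℕ.^ l ℕ.* p ℕ.^ suc d))
    ≡⟨ ≡.cong₂ (λ x y → x ℚ.* ℤ→ℚ y) (powℤℚ-negsuc p d) (ℤ.pos-* (p ℕ.^ l) (p ℕ.^ suc d)) ⟩
  ((+ 1) ℚ./ (p ℕ.^ suc d)) ℚ.* ℤ→ℚ (+ (p ℕ.^ l) ℤ.* + (p ℕ.^ suc d))
    ≡⟨ ℚ.*-comm ((+ 1) ℚ./ (p ℕ.^ suc d)) (ℤ→ℚ (+ (p ℕ.^ l) ℤ.* + (p ℕ.^ suc d))) ⟩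
  ℤ→ℚ (+ (p ℕ.^ l) ℤ.* + (p ℕ.^ suc d)) ℚ.* ((+ 1) ℚ./ (p ℕ.^ suc d))
    ≡⟨ ℤ→ℚ-cancel (+ (p ℕ.^ l)) (p ℕ.^ suc d) ⟩
  ℤ→ℚ (+ (p ℕ.^ l)) ∎
  where
  open ≡.≡-Reasoning
  instance
    p^≢0 : ℕ.NonZero (p ℕ.^ suc d)
    p^≢0 = ℕ.m^n≢0 p (suc d)
  exponent : ∀ l d → ℤ.- (((1ℤ ℤ.+ l) ℤ.+ d) ℤ.- l) ≡ ℤ.- (1ℤ ℤ.+ d)
  exponent = ℤ-Tactic.solve-∀

-- Inserting p^m and its inverse treats both signs of m - l at once: only nonnegative powers occur
-- in the hypothesis.
powℤℚ-*-cancel : ∀ p .{{_ : ℕ.NonZero p}} l m T N → + (p ℕ.^ l) ℤ.* T ≡ N ℤ.* + (p ℕ.^ m) →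
  powℤℚ p (ℤ.- (+ m ℤ.- + l)) ℚ.* ℤ→ℚ T ≡ ℤ→ℚ N
powℤℚ-*-cancel p l m T N p^l*T≡N*p^m = begin
  P ℚ.* ℤ→ℚ T                                   ≡⟨ ≡.cong (P ℚ.*_) (ℤ→ℚ-cancel T (p ℕ.^ m)) ⟨
  P ℚ.* (ℤ→ℚ (T ℤ.* + (p ℕ.^ m)) ℚ.* I)         ≡⟨ ≡.cong (λ x → P ℚ.* (x ℚ.* I)) (≡.trans (≡.cong ℤ→ℚ (ℤ.*-comm T (+ (p ℕ.^ m)))) (ℤ→ℚ-* (+ (p ℕ.^ m)) T)) ⟩
  P ℚ.* ((ℤ→ℚ (+ (p ℕ.^ m)) ℚ.* ℤ→ℚ T) ℚ.* I)   ≡⟨ ≡.cong (P ℚ.*_) (ℚ.*-assoc (ℤ→ℚ (+ (p ℕ.^ m))) (ℤ→ℚ T) I) ⟩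
  P ℚ.* (ℤ→ℚ (+ (p ℕ.^ m)) ℚ.* (ℤ→ℚ T ℚ.* I))   ≡⟨ ℚ.*-assoc P (ℤ→ℚ (+ (p ℕ.^ m))) (ℤ→ℚ T ℚ.* I) ⟨
  (P ℚ.* ℤ→ℚ (+ (p ℕ.^ m))) ℚ.* (ℤ→ℚ T ℚ.* I)   ≡⟨ ≡.cong (ℚ._* (ℤ→ℚ T ℚ.* I)) (powℤℚ-- p l m) ⟩
  ℤ→ℚ (+ (p ℕ.^ l)) ℚ.* (ℤ→ℚ T ℚ.* I)           ≡⟨ ℚ.*-assoc (ℤ→ℚ (+ (p ℕ.^ l))) (ℤ→ℚ T) I ⟨
  (ℤ→ℚ (+ (p ℕ.^ l)) ℚ.* ℤ→ℚ T) ℚ.* I           ≡⟨ ≡.cong (ℚ._* I) (≡.trans (≡.sym (ℤ→ℚ-* (+ (p ℕ.^ l)) T)) (≡.cong ℤ→ℚ p^l*T≡N*p^m)) ⟩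
  ℤ→ℚ (N ℤ.* + (p ℕ.^ m)) ℚ.* I                 ≡⟨ ℤ→ℚ-cancel N (p ℕ.^ m) ⟩
  ℤ→ℚ N                                         ∎
  where
  open ≡.≡-Reasoning
  instance
    p^≢0 : ℕ.NonZero (p ℕ.^ m)
    p^≢0 = ℕ.m^n≢0 p m
  P I : ℚ
  P = powℤℚ p (ℤ.- (+ m ℤ.- + l))
  I = (+ 1) ℚ./ (p ℕ.^ m)

-- The numerator is (m - l) φ(q) + φ(q) - 1 with q = p^(b+1). The remainder is the largest possible,
-- so n is the last degree with this exponent.
bracketExp≡ : ∀ {p} → Prime p → ∀ b l m →
  bracketExp ((l ℕ.+ 1) ℕ.* p ℕ.^ b ℕ.∸ 1 ℕ.+ suc m ℕ.* φ (p ℕ.^ suc b)) l p (suc b) ≡ + m ℤ.- + l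
bracketExp≡ {p} pp b l m = begin
  floorDiv (+ n ℤ.- + Q ℤ.- + (l ℕ.* p ℕ.^ suc b)) (φ (p ℕ.^ suc b))
    ≡⟨ floorDiv≡/ℕ _ (φ (p ℕ.^ suc b)) ⟩
  (+ n ℤ.- + Q ℤ.- + (l ℕ.* p ℕ.^ suc b)) ℤ./ℕ φ (p ℕ.^ suc b)
    ≡⟨ ≡.cong (ℤ._/ℕ φ (p ℕ.^ suc b)) numerator ⟩
  (+ (φ (p ℕ.^ suc b) ℕ.∸ 1) ℤ.+ (+ m ℤ.- + l) ℤ.* + φ (p ℕ.^ suc b)) ℤ./ℕ φ (p ℕ.^ suc b)
    ≡⟨ /ℕ-unique (φ (p ℕ.^ suc b)) (+ m ℤ.- + l) (ℕ.≤-reflexive (ℕ.suc-pred (φ (p ℕ.^ suc b)))) ⟩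
  + m ℤ.- + l ∎
  where
  open ≡.≡-Reasoning
  Q n : ℕ
  Q = p ℕ.^ b
  n = (l ℕ.+ 1) ℕ.* p ℕ.^ b ℕ.∸ 1 ℕ.+ suc m ℕ.* φ (p ℕ.^ suc b)
  instance
    p≢0 : ℕ.NonZero p
    p≢0 = prime⇒nonZero pp
    p-1≢0 : ℕ.NonZero (p ℕ.∸ 1)
    p-1≢0 = ℕ.>-nonZero (ℕ.m<n⇒0<n∸m (ℕ.nonTrivial⇒n>1 p {{prime⇒nonTrivial pp}}))
    Q≢0 : ℕ.NonZero (p ℕ.^ b)
    Q≢0 = ℕ.m^n≢0 p b
    φ≢0 : ℕ.NonZero (φ (p ℕ.^ suc b))
    φ≢0 = ≡.subst ℕ.NonZero (≡.sym (φ-prime-power {b = b} pp)) (ℕ.m*n≢0 (p ℕ.^ b) (p ℕ.∸ 1))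
  pos-∸1 : ∀ k .{{_ : ℕ.NonZero k}} → + (k ℕ.∸ 1) ≡ + k ℤ.- 1ℤ
  pos-∸1 (suc k) = ≡.refl
  first : + ((l ℕ.+ 1) ℕ.* Q ℕ.∸ 1) ≡ (+ l ℤ.+ 1ℤ) ℤ.* + Q ℤ.- 1ℤ
  first = ≡.trans (pos-∸1 ((l ℕ.+ 1) ℕ.* Q) {{ℕ.m*n≢0 (l ℕ.+ 1) Q {{≡.subst ℕ.NonZero (ℕ.+-comm 1 l) _}}}})
    (≡.cong (ℤ._- 1ℤ) (ℤ.pos-* (l ℕ.+ 1) Q))
  +φ : + φ (p ℕ.^ suc b) ≡ + Q ℤ.* (+ p ℤ.- 1ℤ)
  +φ = ≡.trans (≡.cong +_ (φ-prime-power {b = b} pp)) (≡.trans (ℤ.pos-* Q (p ℕ.∸ 1)) (≡.cong (+ Q ℤ.*_) (pos-∸1 p)))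
  identity : ∀ l m Q p → ((l ℤ.+ 1ℤ) ℤ.* Q ℤ.- 1ℤ ℤ.+ (1ℤ ℤ.+ m) ℤ.* (Q ℤ.* (p ℤ.- 1ℤ))) ℤ.- Q ℤ.- l ℤ.* (p ℤ.* Q)
    ≡ (Q ℤ.* (p ℤ.- 1ℤ) ℤ.- 1ℤ) ℤ.+ (m ℤ.- l) ℤ.* (Q ℤ.* (p ℤ.- 1ℤ))
  identity = ℤ-Tactic.solve-∀
  numerator : + n ℤ.- + Q ℤ.- + (l ℕ.* p ℕ.^ suc b) ≡ + (φ (p ℕ.^ suc b) ℕ.∸ 1) ℤ.+ (+ m ℤ.- + l) ℤ.* + φ (p ℕ.^ suc b)
  numerator = begin
    + n ℤ.- + Q ℤ.- + (l ℕ.* p ℕ.^ suc b)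
      ≡⟨ ≡.cong₂ (λ x y → x ℤ.- + Q ℤ.- y)
           (≡.cong₂ ℤ._+_ first (≡.trans (ℤ.pos-* (suc m) (φ (p ℕ.^ suc b))) (≡.cong (+ suc m ℤ.*_) +φ)))
           (≡.trans (ℤ.pos-* l (p ℕ.^ suc b)) (≡.cong (+ l ℤ.*_) (ℤ.pos-* p Q))) ⟩
    ((+ l ℤ.+ 1ℤ) ℤ.* + Q ℤ.- 1ℤ ℤ.+ (1ℤ ℤ.+ + m) ℤ.* (+ Q ℤ.* (+ p ℤ.- 1ℤ))) ℤ.- + Q ℤ.- + l ℤ.* (+ p ℤ.* + Q)
      ≡⟨ identity (+ l) (+ m) (+ Q) (+ p) ⟩
    (+ Q ℤ.* (+ p ℤ.- 1ℤ) ℤ.- 1ℤ) ℤ.+ (+ m ℤ.- + l) ℤ.* (+ Q ℤ.* (+ p ℤ.- 1ℤ))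
      ≡⟨ ≡.cong (λ x → (x ℤ.- 1ℤ) ℤ.+ (+ m ℤ.- + l) ℤ.* x) +φ ⟨
    (+ φ (p ℕ.^ suc b) ℤ.- 1ℤ) ℤ.+ (+ m ℤ.- + l) ℤ.* + φ (p ℕ.^ suc b)
      ≡⟨ ≡.cong (ℤ._+ (+ m ℤ.- + l) ℤ.* + φ (p ℕ.^ suc b)) (pos-∸1 (φ (p ℕ.^ suc b))) ⟨
    + (φ (p ℕ.^ suc b) ℕ.∸ 1) ℤ.+ (+ m ℤ.- + l) ℤ.* + φ (p ℕ.^ suc b) ∎

-- Integrality and the congruence for the bracket

open import Data.Nat using (_+_; _*_; _∸_; _^_; _≤_)
open import Data.Integer.Divisibility using (_∣_)

theorem1p5 : (p : ℕ) → Prime p → (a : ℕ) → 1 ≤ a → (l m : ℕ) → 1 ≤ m →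
  (n : ℕ) → n ≡ (l + 1) * p ^ (a ∸ 1) ∸ 1 + m * φ (p ^ a) →
  (r : ℤ) →
  ∃ λ (N : ℤ) → bracket n r l p a ≡ ℤ→ℚ N ×
    (+ p) ∣ (N ℤ.- (((ℤ.- (+ 1)) ℤ.^ (m ∸ 1)) ℤ.* (+ ((m ∸ 1) C l))))
theorem1p5 zero pp = ⊥-elim (¬prime[0] pp)
theorem1p5 (suc zero) pp = ⊥-elim (¬prime[1] pp)
theorem1p5 p@(suc (suc r′)) pp (suc b) _ l (suc m) _ n n≡ r = N , bracket≡N , ℤ∣.∣⇒∣ᵤ (ℤ∣.divides t (cancel c (t ℤ.* + p)))
  where
  open Congruence r′ pp b using (δ̃; leading; ⟦z^n⟧δ̃)
  open ≡.≡-Reasoning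
  instance
    q≢0 : ℕ.NonZero (p ℕ.^ suc b)
    q≢0 = ℕ.m^n≢0 p (suc b)
  T : ℤ
  T = ⟦ z ^ᵒ n ⟧ (δ (p ℕ.^ suc b) l) (ℤ.- r)
  n≡′ : n ≡ (l ℕ.+ 1) ℕ.* p ℕ.^ b ℕ.∸ 1 ℕ.+ suc m ℕ.* (p ℕ.^ b ℕ.* suc r′)
  n≡′ = ≡.trans n≡ (≡.cong (λ x → (l ℕ.+ 1) ℕ.* p ℕ.^ b ℕ.∸ 1 ℕ.+ suc m ℕ.* x) (φ-prime-power {b = b} pp))
  congruence : + (p ℕ.^ suc m) ∣ᶻ + (p ℕ.^ l) ℤ.* T ℤ.- leading m l
  congruence = ≡.subst (λ x → + (p ℕ.^ suc m) ∣ᶻ x ℤ.- leading m l)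
    (⟦⟧-* (z ^ᵒ n) (+ (p ℕ.^ l)) (δ (p ℕ.^ suc b) l) (ℤ.- r))
    (≡.subst (λ n → + (p ℕ.^ suc m) ∣ᶻ ⟦ z ^ᵒ n ⟧ (δ̃ l) (ℤ.- r) ℤ.- leading m l) (≡.sym n≡′) (at (⟦z^n⟧δ̃ m l) (ℤ.- r)))
  t c N : ℤ
  t = ℤ∣.quotient congruence
  c = -1ℤ ℤ.^ m ℤ.* + (m C l)
  -- The congruence reads p^l T = c p^m + t p^(m+1); dividing by p^m gives the bracket, so
  -- integrality and its residue c modulo p come together.
  N = t ℤ.* + p ℤ.+ c
  cancel : ∀ c x → (x ℤ.+ c) ℤ.- c ≡ x
  cancel = ℤ-Tactic.solve-∀
  collect : ∀ x ε k P p t → x ℤ.- ε ℤ.* (k ℤ.* P) ≡ t ℤ.* (p ℤ.* P) → x ≡ (t ℤ.* p ℤ.+ ε ℤ.* k) ℤ.* P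
  collect x ε k P p t eq = ≡.trans (expand x (ε ℤ.* (k ℤ.* P))) (≡.trans (≡.cong (ℤ._+ ε ℤ.* (k ℤ.* P)) eq) (factor ε k P p t))
    where
    expand : ∀ x y → x ≡ (x ℤ.- y) ℤ.+ y
    expand = ℤ-Tactic.solve-∀
    factor : ∀ ε k P p t → t ℤ.* (p ℤ.* P) ℤ.+ ε ℤ.* (k ℤ.* P) ≡ (t ℤ.* p ℤ.+ ε ℤ.* k) ℤ.* P
    factor = ℤ-Tactic.solve-∀
  p^l*T≡N*p^m : + (p ℕ.^ l) ℤ.* T ≡ N ℤ.* + (p ℕ.^ m)
  p^l*T≡N*p^m = collect (+ (p ℕ.^ l) ℤ.* T) (-1ℤ ℤ.^ m) (+ (m C l)) (+ (p ℕ.^ m)) (+ p) t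
    (≡.trans (ℤ∣._∣_.equality congruence) (≡.cong (t ℤ.*_) (ℤ.pos-* p (p ℕ.^ m))))
  bracket≡N : bracket n r l p (suc b) ≡ ℤ→ℚ N
  bracket≡N = begin
    powℤℚ p (ℤ.- bracketExp n l p (suc b)) ℚ.* innerSum n r l p (suc b)
      ≡⟨ ≡.cong₂ (λ e x → powℤℚ p (ℤ.- e) ℚ.* x)
           (≡.trans (≡.cong (λ n → bracketExp n l p (suc b)) n≡) (bracketExp≡ pp b l m)) (innerSum≡⟦z^n⟧δ n r l p (suc b)) ⟩
    powℤℚ p (ℤ.- (+ m ℤ.- + l)) ℚ.* ℤ→ℚ T
      ≡⟨ powℤℚ-*-cancel p l m T N p^l*T≡N*p^m ⟩
    ℤ→ℚ N ∎
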